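{- Let $\Phi=(D,\varphi)$ be a $\mathbb{T}$-gain digraph. Then $\Phi$ is cycle balanced if and only if $A(\Phi)$ is cospectral with $A(D)$.
   Context: A digraph $D=(V,\mathcal{A})$ has a finite vertex set $V=\{v_1,\dots,v_n\}$ and a set $\mathcal{A}$ of ordered pairs of distinct vertices, called arcs (no loops; at most one arc from $v_i$ to $v_j$ for each ordered pair; opposite arcs $(u,v)$, $(v,u)$ may both be present). A directed cycle is a closed directed walk whose vertices are distinct except that the first and last coincide (so its length is at least $2$; a cycle of length $2$, i.e. a pair of opposite arcs, is allowed). Let $\mathbb{T}=\{z\in\mathbb{C}:|z|=1\}$. A $\mathbb{T}$-gain digraph is a pair $\Phi=(D,\varphi)$ with $D$ a digraph and $\varphi:\mathcal{A}\to\mathbb{T}$ an arbitrary function (no relation between the gains of opposite arcs is imposed). Its gain adjacency matrix $A(\Phi)\in M_n(\mathbb{C})$ has entries $A(\Phi)_{ij}=\varphi(v_i,v_j)$ if $(v_i,v_j)\in\mathcal{A}$ and $0$ otherwise. $A(D)$ is the $0/1$ adjacency matrix, $A(D)_{ij}=1$ if $(v_i,v_j)\in\mathcal{A}$ and $0$ otherwise. The gain $\varphi(C)$ of a directed cycle $C$ is the product of the gains of its arcs. $\Phi$ is cycle balanced if $\varphi(C)=1$ for every directed cycle $C$ of $D$. Two matrices are cospectral if they have the same characteristic polynomial. -}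

module Defs where

open import Algebra.Bundles using (RawRing)
import Algebra.Definitions.RawMonoid as RawMonoidOps
import Algebra.Definitions.RawSemiring as RawSemiringOps
open import Data.Bool.Base using (Bool; true; false; T; if_then_else_)
open import Data.Fin.Base using (Fin; zero; suc; toℕ; punchIn)
open import Data.Fin.Properties using (_≟_)
open import Data.List.Base using (List; []; _∷_; map)
open import Data.List.Relation.Unary.Unique.Propositional using (Unique)
open import Data.Nat.Base as ℕ using (ℕ; zero; suc)
import Data.Nat.Properties as ℕ
open import Data.Product.Base using (Σ; ∃; _×_; _,_; proj₁; proj₂)
open import Data.Rational.Base as ℚ using (ℚ; 0ℚ; 1ℚ; ½)
import Data.Rational.Properties as ℚ
open import Data.Rational.Solver using (module +-*-Solver)
open import Data.Unit.Base using (tt)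
open import Data.Vec.Functional using (Vector)
open import Level using (0ℓ)
open import Relation.Binary.PropositionalEquality
  using (_≡_; refl; sym; trans; cong; cong₂; subst)
open import Relation.Nullary.Decidable using (does)

------------------------------------------------------------------------
-- Real numbers: Cauchy sequences of rationals, considered up to sequences
-- tending to 0. Quotients are not available, so the identification is
-- the relation _≈ℝ_.

IsCauchy : (ℕ → ℚ) → Set
IsCauchy x = ∀ ε → 0ℚ ℚ.< ε → ∃ λ N → ∀ m n → N ℕ.≤ m → N ℕ.≤ n →
  ℚ.∣ x m ℚ.- x n ∣ ℚ.< ε

record ℝ : Set where
  no-eta-equality
  constructor mkℝ
  field
    seq    : ℕ → ℚ
    cauchy : IsCauchy seq

open ℝ public

infix 4 _≈ℝ_ _≤ℝ_

record _≈ℝ_ (x y : ℝ) : Set where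
  constructor mk≈
  field
    close : ∀ ε → 0ℚ ℚ.< ε → ∃ λ N → ∀ n → N ℕ.≤ n →
      ℚ.∣ seq x n ℚ.- seq y n ∣ ℚ.< ε

record _≤ℝ_ (x y : ℝ) : Set where
  constructor mk≤
  field
    below : ∀ ε → 0ℚ ℚ.< ε → ∃ λ N → ∀ n → N ℕ.≤ n →
      seq x n ℚ.< seq y n ℚ.+ ε

fromℚ : ℚ → ℝ
seq    (fromℚ q) _ = q
cauchy (fromℚ q) ε 0<ε = 0 , λ _ _ _ _ →
  subst (ℚ._< ε) (sym (cong ℚ.∣_∣ (ℚ.+-inverseʳ q))) 0<ε

private
  halve : ∀ ε → ½ ℚ.* ε ℚ.+ ½ ℚ.* ε ≡ ε
  halve ε = trans (sym (ℚ.*-distribʳ-+ ε ½ ½)) (ℚ.*-identityˡ ε)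

  half-pos : ∀ {ε} → 0ℚ ℚ.< ε → 0ℚ ℚ.< ½ ℚ.* ε
  half-pos 0<ε = ℚ.*-monoʳ-<-pos ½ 0<ε

  -- Every Cauchy sequence is eventually bounded by some B > 0.
  bound : ∀ x → IsCauchy x → ∃ λ B → (0ℚ ℚ.< B) × (∃ λ N → ∀ n → N ℕ.≤ n → ℚ.∣ x n ∣ ℚ.≤ B)
  bound x cx with cx 1ℚ (ℚ.positive⁻¹ 1ℚ)
  ... | N , near = B , 0<B , N , below
    where
    B = 1ℚ ℚ.+ ℚ.∣ x N ∣

    0<B : 0ℚ ℚ.< B
    0<B = ℚ.+-mono-<-≤ (ℚ.positive⁻¹ 1ℚ) (ℚ.0≤∣p∣ (x N))

    split : ∀ a b → a ≡ (a ℚ.- b) ℚ.+ b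
    split = solve 2 (λ a b → a := (a :- b) :+ b) refl
      where open +-*-Solver

    below : ∀ n → N ℕ.≤ n → ℚ.∣ x n ∣ ℚ.≤ B
    below n N≤n = begin
      ℚ.∣ x n ∣                        ≡⟨ cong ℚ.∣_∣ (split (x n) (x N)) ⟩
      ℚ.∣ (x n ℚ.- x N) ℚ.+ x N ∣      ≤⟨ ℚ.∣p+q∣≤∣p∣+∣q∣ (x n ℚ.- x N) (x N) ⟩
      ℚ.∣ x n ℚ.- x N ∣ ℚ.+ ℚ.∣ x N ∣  ≤⟨ ℚ.+-monoˡ-≤ ℚ.∣ x N ∣ (ℚ.<⇒≤ (near n N N≤n ℕ.≤-refl)) ⟩
      B                                ∎
      where open ℚ.≤-Reasoning

  -- For B > 0 and ε > 0, some δ > 0 has B δ = ε.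
  divide : ∀ B ε → 0ℚ ℚ.< B → 0ℚ ℚ.< ε → ∃ λ δ → (0ℚ ℚ.< δ) × (B ℚ.* δ ≡ ε)
  divide B ε 0<B 0<ε = B⁻¹ ℚ.* ε , 0<δ , eq
    where
    instance
      B-pos : ℚ.Positive B
      B-pos = ℚ.positive 0<B
      B-nonZero : ℚ.NonZero B
      B-nonZero = ℚ.pos⇒nonZero B
    B⁻¹ = ℚ.1/ B
    0<δ : 0ℚ ℚ.< B⁻¹ ℚ.* ε
    0<δ = subst (ℚ._< B⁻¹ ℚ.* ε) (ℚ.*-zeroʳ B⁻¹)
      (ℚ.*-monoʳ-<-pos B⁻¹ {{ℚ.1/pos⇒pos B}} 0<ε)
    eq : B ℚ.* (B⁻¹ ℚ.* ε) ≡ ε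
    eq = trans (sym (ℚ.*-assoc B B⁻¹ ε))
      (trans (cong (ℚ._* ε) (ℚ.*-inverseʳ B)) (ℚ.*-identityˡ ε))

  +-cauchy : ∀ x y → IsCauchy x → IsCauchy y → IsCauchy (λ n → x n ℚ.+ y n)
  +-cauchy x y cx cy ε 0<ε
    with cx (½ ℚ.* ε) (half-pos 0<ε) | cy (½ ℚ.* ε) (half-pos 0<ε)
  ... | N₁ , h₁ | N₂ , h₂ = N₁ ℕ.⊔ N₂ , λ m n N≤m N≤n → begin-strict
      ℚ.∣ (x m ℚ.+ y m) ℚ.- (x n ℚ.+ y n) ∣        ≡⟨ cong ℚ.∣_∣ (regroup (x m) (y m) (x n) (y n)) ⟩
      ℚ.∣ (x m ℚ.- x n) ℚ.+ (y m ℚ.- y n) ∣        ≤⟨ ℚ.∣p+q∣≤∣p∣+∣q∣ (x m ℚ.- x n) (y m ℚ.- y n) ⟩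
      ℚ.∣ x m ℚ.- x n ∣ ℚ.+ ℚ.∣ y m ℚ.- y n ∣      <⟨ ℚ.+-mono-<
        (h₁ m n (ℕ.m⊔n≤o⇒m≤o N₁ N₂ N≤m) (ℕ.m⊔n≤o⇒m≤o N₁ N₂ N≤n))
        (h₂ m n (ℕ.m⊔n≤o⇒n≤o N₁ N₂ N≤m) (ℕ.m⊔n≤o⇒n≤o N₁ N₂ N≤n)) ⟩
      ½ ℚ.* ε ℚ.+ ½ ℚ.* ε                          ≡⟨ halve ε ⟩
      ε                                            ∎
    where
    open ℚ.≤-Reasoning
    regroup : ∀ a b c d → (a ℚ.+ b) ℚ.- (c ℚ.+ d) ≡ (a ℚ.- c) ℚ.+ (b ℚ.- d)
    regroup = solve 4 (λ a b c d → (a :+ b) :- (c :+ d) := (a :- c) :+ (b :- d)) refl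
      where open +-*-Solver

  neg-cauchy : ∀ x → IsCauchy x → IsCauchy (λ n → ℚ.- x n)
  neg-cauchy x cx ε 0<ε with cx ε 0<ε
  ... | N , h = N , λ m n N≤m N≤n →
      subst (ℚ._< ε) (cong ℚ.∣_∣ (swap (x m) (x n))) (h n m N≤n N≤m)
    where
    swap : ∀ a b → b ℚ.- a ≡ (ℚ.- a) ℚ.- (ℚ.- b)
    swap = solve 2 (λ a b → b :- a := (:- a) :- (:- b)) refl
      where open +-*-Solver

  product-estimate : ∀ a b c d {B C δ η} → 0ℚ ℚ.< B → 0ℚ ℚ.< C →
    ℚ.∣ b ∣ ℚ.≤ C → ℚ.∣ c ∣ ℚ.≤ B → ℚ.∣ a ℚ.- c ∣ ℚ.< δ → ℚ.∣ b ℚ.- d ∣ ℚ.< η →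
    ℚ.∣ a ℚ.* b ℚ.- c ℚ.* d ∣ ℚ.< C ℚ.* δ ℚ.+ B ℚ.* η
  product-estimate a b c d {B} {C} {δ} {η} 0<B 0<C b≤C c≤B dx<δ dy<η = begin-strict
      ℚ.∣ a ℚ.* b ℚ.- c ℚ.* d ∣
        ≡⟨ cong ℚ.∣_∣ (regroup a b c d) ⟩
      ℚ.∣ b ℚ.* (a ℚ.- c) ℚ.+ c ℚ.* (b ℚ.- d) ∣
        ≤⟨ ℚ.∣p+q∣≤∣p∣+∣q∣ (b ℚ.* (a ℚ.- c)) (c ℚ.* (b ℚ.- d)) ⟩
      ℚ.∣ b ℚ.* (a ℚ.- c) ∣ ℚ.+ ℚ.∣ c ℚ.* (b ℚ.- d) ∣
        ≡⟨ cong₂ ℚ._+_ (ℚ.∣p*q∣≡∣p∣*∣q∣ b (a ℚ.- c)) (ℚ.∣p*q∣≡∣p∣*∣q∣ c (b ℚ.- d)) ⟩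
      ℚ.∣ b ∣ ℚ.* ℚ.∣ a ℚ.- c ∣ ℚ.+ ℚ.∣ c ∣ ℚ.* ℚ.∣ b ℚ.- d ∣
        ≤⟨ ℚ.+-mono-≤
             (ℚ.*-monoʳ-≤-nonNeg ℚ.∣ a ℚ.- c ∣ {{ℚ.nonNegative (ℚ.0≤∣p∣ (a ℚ.- c))}} b≤C)
             (ℚ.*-monoʳ-≤-nonNeg ℚ.∣ b ℚ.- d ∣ {{ℚ.nonNegative (ℚ.0≤∣p∣ (b ℚ.- d))}} c≤B) ⟩
      C ℚ.* ℚ.∣ a ℚ.- c ∣ ℚ.+ B ℚ.* ℚ.∣ b ℚ.- d ∣
        <⟨ ℚ.+-mono-<
             (ℚ.*-monoʳ-<-pos C {{ℚ.positive 0<C}} dx<δ)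
             (ℚ.*-monoʳ-<-pos B {{ℚ.positive 0<B}} dy<η) ⟩
      C ℚ.* δ ℚ.+ B ℚ.* η ∎
    where
    open ℚ.≤-Reasoning
    regroup : ∀ a b c d →
      a ℚ.* b ℚ.- c ℚ.* d ≡ b ℚ.* (a ℚ.- c) ℚ.+ c ℚ.* (b ℚ.- d)
    regroup = solve 4 (λ a b c d →
      a :* b :- c :* d := b :* (a :- c) :+ c :* (b :- d)) refl
      where open +-*-Solver

  *-cauchy : ∀ x y → IsCauchy x → IsCauchy y → IsCauchy (λ n → x n ℚ.* y n)
  *-cauchy x y cx cy ε 0<ε =
    let B , 0<B , M₁ , x≤B = bound x cx
        C , 0<C , M₂ , y≤C = bound y cy
        δ , 0<δ , Cδ = divide C (½ ℚ.* ε) 0<C (half-pos 0<ε)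
        η , 0<η , Bη = divide B (½ ℚ.* ε) 0<B (half-pos 0<ε)
        N₁ , x-near = cx δ 0<δ
        N₂ , y-near = cy η 0<η
        M = M₁ ℕ.⊔ M₂
        K = N₁ ℕ.⊔ N₂
    in M ℕ.⊔ K , λ m n N≤m N≤n →
      let M≤m = ℕ.m⊔n≤o⇒m≤o M K N≤m
          K≤m = ℕ.m⊔n≤o⇒n≤o M K N≤m
          M≤n = ℕ.m⊔n≤o⇒m≤o M K N≤n
          K≤n = ℕ.m⊔n≤o⇒n≤o M K N≤n
      in subst (ℚ.∣ x m ℚ.* y m ℚ.- x n ℚ.* y n ∣ ℚ.<_)
        (trans (cong₂ ℚ._+_ Cδ Bη) (halve ε))
        (product-estimate (x m) (y m) (x n) (y n) 0<B 0<C
          (y≤C m (ℕ.m⊔n≤o⇒n≤o M₁ M₂ M≤m))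
          (x≤B n (ℕ.m⊔n≤o⇒m≤o M₁ M₂ M≤n))
          (x-near m n (ℕ.m⊔n≤o⇒m≤o N₁ N₂ K≤m) (ℕ.m⊔n≤o⇒m≤o N₁ N₂ K≤n))
          (y-near m n (ℕ.m⊔n≤o⇒n≤o N₁ N₂ K≤m) (ℕ.m⊔n≤o⇒n≤o N₁ N₂ K≤n)))

infixl 6 _+ℝ_
infixl 7 _*ℝ_

_+ℝ_ : ℝ → ℝ → ℝ
seq    (x +ℝ y) n = seq x n ℚ.+ seq y n
cauchy (x +ℝ y)   = +-cauchy (seq x) (seq y) (cauchy x) (cauchy y)

_*ℝ_ : ℝ → ℝ → ℝ
seq    (x *ℝ y) n = seq x n ℚ.* seq y n
cauchy (x *ℝ y)   = *-cauchy (seq x) (seq y) (cauchy x) (cauchy y)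

-ℝ_ : ℝ → ℝ
seq    (-ℝ x) n = ℚ.- seq x n
cauchy (-ℝ x)   = neg-cauchy (seq x) (cauchy x)

ℝ-rawRing : RawRing 0ℓ 0ℓ
ℝ-rawRing = record
  { Carrier = ℝ
  ; _≈_     = _≈ℝ_
  ; _+_     = _+ℝ_
  ; _*_     = _*ℝ_
  ; -_      = -ℝ_
  ; 0#      = fromℚ 0ℚ
  ; 1#      = fromℚ 1ℚ
  }

------------------------------------------------------------------------
-- Complex numbers

record ℂ : Set where
  no-eta-equality
  constructor _+i_
  field
    re im : ℝ

open ℂ public

infix 4 _≈ℂ_

record _≈ℂ_ (z w : ℂ) : Set where
  constructor _,≈_
  field
    re≈ : re z ≈ℝ re w
    im≈ : im z ≈ℝ im w

module _ where
  open RawRing ℝ-rawRing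

  infixl 6 _+ℂ_
  infixl 7 _*ℂ_

  _+ℂ_ : ℂ → ℂ → ℂ
  re (z +ℂ w) = re z + re w
  im (z +ℂ w) = im z + im w

  _*ℂ_ : ℂ → ℂ → ℂ
  re (z *ℂ w) = re z * re w + - (im z * im w)
  im (z *ℂ w) = re z * im w + im z * re w

  -ℂ_ : ℂ → ℂ
  re (-ℂ z) = - re z
  im (-ℂ z) = - im z

  ℂ-rawRing : RawRing 0ℓ 0ℓ
  ℂ-rawRing = record
    { Carrier = ℂ
    ; _≈_     = _≈ℂ_
    ; _+_     = _+ℂ_
    ; _*_     = _*ℂ_
    ; -_      = -ℂ_
    ; 0#      = 0# +i 0#
    ; 1#      = 1# +i 0#
    }

  -- |z| = r, i.e. r is the nonnegative square root of (re z)² + (im z)².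
  HasModulus : ℂ → ℝ → Set
  HasModulus z r = (0# ≤ℝ r) × (r * r ≈ re z * re z + im z * im z)

  𝕋 : Set
  𝕋 = Σ ℂ λ z → HasModulus z 1#

------------------------------------------------------------------------
-- Polynomials, determinants and characteristic polynomials

module Polynomial {c ℓ} (R : RawRing c ℓ) where
  open RawRing R

  -- a₀ ∷ a₁ ∷ … ∷ [] stands for a₀ + a₁ X + …; trailing zeros are allowed,
  -- and equality compares coefficients.
  Poly : Set c
  Poly = List Carrier

  coeff : Poly → ℕ → Carrier
  coeff []      _       = 0#
  coeff (a ∷ _) zero    = a
  coeff (_ ∷ p) (suc k) = coeff p k

  infixl 6 _+ᵖ_
  infixl 7 _*ᵖ_

  _+ᵖ_ : Poly → Poly → Poly
  []      +ᵖ q       = q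
  (a ∷ p) +ᵖ []      = a ∷ p
  (a ∷ p) +ᵖ (b ∷ q) = (a + b) ∷ (p +ᵖ q)

  _*ᵖ_ : Poly → Poly → Poly
  []      *ᵖ q = []
  (a ∷ p) *ᵖ q = map (a *_) q +ᵖ (0# ∷ (p *ᵖ q))

  const : Carrier → Poly
  const a = a ∷ []

  X : Poly
  X = 0# ∷ 1# ∷ []

  polyRawRing : RawRing c ℓ
  polyRawRing = record
    { Carrier = Poly
    ; _≈_     = λ p q → ∀ k → coeff p k ≈ coeff q k
    ; _+_     = _+ᵖ_
    ; _*_     = _*ᵖ_
    ; -_      = map (-_)
    ; 0#      = []
    ; 1#      = const 1#
    }

Matrix : ∀ {a} → Set a → ℕ → Set a
Matrix A n = Vector (Vector A n) n

module Determinant {c ℓ} (R : RawRing c ℓ) where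
  open RawRing R
  open RawMonoidOps +-rawMonoid using (sum)
  open RawSemiringOps rawSemiring using (_^_)

  -- Laplace expansion along the first row.
  det : ∀ {n} → Matrix Carrier n → Carrier
  det {zero}  _ = 1#
  det {suc n} M = sum λ j →
    (- 1#) ^ toℕ j * M zero j * det (λ i k → M (suc i) (punchIn j k))

module CharacteristicPolynomial {c ℓ} (R : RawRing c ℓ) where
  open RawRing R using (Carrier)
  open Polynomial R
  open RawRing polyRawRing using (_≈_; _+_; -_; 0#)
  open Determinant polyRawRing using (det)

  charpoly : ∀ {n} → Matrix Carrier n → Poly
  charpoly A = det λ i j → (if does (i ≟ j) then X else 0#) + - const (A i j)

  Cospectral : ∀ {n} → Matrix Carrier n → Matrix Carrier n → Set ℓ
  Cospectral A B = charpoly A ≈ charpoly B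

open CharacteristicPolynomial ℂ-rawRing public using (charpoly; Cospectral)

------------------------------------------------------------------------
-- Digraphs and gains

-- The vertex set is Fin n. Arcs are given by a Boolean function, so that
-- there is at most one arc from u to v.
record Digraph (n : ℕ) : Set where
  field
    arc?     : Fin n → Fin n → Bool
    loopless : ∀ v → arc? v v ≡ false

  Arc : Fin n → Fin n → Set
  Arc u v = T (arc? u v)

  infixr 5 _∷_

  data Walk : Fin n → Fin n → Set where
    []  : ∀ {u} → Walk u u
    _∷_ : ∀ {u v w} → Arc u v → Walk v w → Walk u w

  length : ∀ {u v} → Walk u v → ℕ
  length []      = 0
  length (_ ∷ p) = suc (length p)

  -- The vertices met along a walk, the final one omitted.
  vertices : ∀ {u v} → Walk u v → List (Fin n)
  vertices []            = []
  vertices (_∷_ {u} _ p) = u ∷ vertices p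

  IsCycle : ∀ {v} → Walk v v → Set
  IsCycle p = (2 ℕ.≤ length p) × Unique (vertices p)

record GainDigraph (n : ℕ) : Set where
  field
    digraph : Digraph n

  open Digraph digraph public

  field
    φ : ∀ {u v} → Arc u v → 𝕋

  open RawRing ℂ-rawRing

  gain : ∀ {u v} → Walk u v → ℂ
  gain []      = 1#
  gain (a ∷ p) = proj₁ (φ a) * gain p

  CycleBalanced : Set
  CycleBalanced = ∀ {v} (p : Walk v v) → IsCycle p → gain p ≈ 1#

module _ where
  open RawRing ℂ-rawRing

  -- f applied to the (unique) proof that b is true if there is one, else 0.
  entry : (b : Bool) → (T b → ℂ) → ℂ
  entry true  f = f tt
  entry false _ = 0#

  adjacency : ∀ {n} → Digraph n → Matrix ℂ n
  adjacency D u v = if Digraph.arc? D u v then 1# else 0#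

  gainAdjacency : ∀ {n} → GainDigraph n → Matrix ℂ n
  gainAdjacency Φ u v = entry (arc? u v) λ a → proj₁ (φ a)
    where open GainDigraph Φ

{-# OPTIONS --safe #-}
module Submission where

-- For a square matrix A over a commutative ring, write p for det (X - A) and B for its
-- adjugate. Comparing coefficients in (X - A) B = p I, and in Jacobi's formula p′ = tr B,
-- gives Newton's identities between the coefficients of p and the power traces of A.
-- Hence, when division by positive integers is possible, two matrices of the same size are
-- cospectral iff tr (A^s) agrees for all s.
--
-- The trace of A(Φ)^s is the sum of the gains of the closed walks of length s, and that of
-- A(D)^s is their number. If Φ is cycle balanced then every closed walk has gain 1, since
-- it can be cut at a repeated vertex into two shorter closed walks. Conversely, if a sum of
-- unit complex numbers equals the number of its terms, then each 1 - z has nonnegative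
-- real part and these add up to 0, so every term is 1.

open import Defs
open import Data.Nat.Base using (ℕ)
open import Function.Bundles using (_⇔_)

open import Algebra.Bundles using (CommutativeRing; RawRing)
open import Data.Bool.Base using (true; false; T; if_then_else_)
open import Data.Empty using (⊥-elim)
open import Data.Fin.Base using (Fin; zero; suc; toℕ; punchIn; inject₁)
open import Data.Fin.Properties using (_≟_; toℕ-inject₁)
open import Data.List.Base using ([]; _∷_; map)
open import Data.List.Membership.DecPropositional using (_∈?_)
open import Data.List.Membership.Propositional using (_∈_)
open import Data.List.Relation.Unary.All.Properties using (¬Any⇒All¬)
open import Data.List.Relation.Unary.AllPairs using ([]; _∷_)
open import Data.List.Relation.Unary.Any using (here; there)
open import Data.List.Relation.Unary.Unique.Propositional using (Unique)
open import Data.Nat.Base as ℕ using (zero; suc; z≤n; s≤s)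
open import Data.Nat.Induction using (<-rec)
import Data.Nat.Properties as ℕ
open import Data.Product.Base using (_×_; _,_; proj₁; proj₂; ∃; ∃₂)
open import Data.Rational.Base as ℚ using (ℚ; 0ℚ; 1ℚ; ½)
import Data.Rational.Properties as ℚ
open import Data.Rational.Solver using (module +-*-Solver)
open import Data.Sum.Base using (_⊎_; inj₁; inj₂)
open import Data.Unit.Base using (tt)
open import Data.Vec.Functional using (Vector; updateAt; tail)
open import Data.Vec.Functional.Properties using (updateAt-updates; updateAt-minimal; updateAt-id-local; map-updateAt)
open import Function.Base using (_∘_; const)
open import Function.Bundles using (mk⇔)
open import Level using (0ℓ)
open import Relation.Binary.PropositionalEquality as ≡ using (_≡_; _≢_)
open import Relation.Nullary.Decidable using (does; yes; no; dec-true; dec-false)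
open import Relation.Nullary.Negation using (contradiction)

-- The determinant is given by Laplace expansion along the first row, without permutations, so its
-- vanishing on equal rows needs an induction of its own. Everything after that is phrased by
-- replacing a row: a cofactor is a full-size determinant with one row replaced by a unit vector,
-- which makes (X - A) B = p I, Jacobi's formula and the degree bounds consequences of linearity in
-- a row. Newton's identities are never expanded into sums. If B_m is the coefficient of X^m in B,
-- the numbers tr (A^s B_(m-1)) obey a one-step recursion from (s, m) to (s + 1, m + 1), with known
-- values at m = 0, at m = n + 1 and, by Jacobi, at s = 0. Both implications move along these
-- diagonals; those starting on the edge m = 0 give the powers beyond n. Order and equality of
-- Cauchy reals are not decidable, so the final positivity argument is carried out on rational terms
-- that are eventually within ε.

punchIn-inject₁ : ∀ {n} (p q : Fin n) → toℕ p ℕ.≤ toℕ q → punchIn (inject₁ p) q ≡ suc q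
punchIn-inject₁ zero    q       _         = ≡.refl
punchIn-inject₁ (suc p) (suc q) (s≤s p≤q) = ≡.cong suc (punchIn-inject₁ p q p≤q)

punchIn-suc : ∀ {n} (p q : Fin n) → toℕ p ℕ.≤ toℕ q → punchIn (suc q) p ≡ inject₁ p
punchIn-suc zero    q       _         = ≡.refl
punchIn-suc (suc p) (suc q) (s≤s p≤q) = ≡.cong suc (punchIn-suc p q p≤q)

-- Two distinct columns are written `inject₁ p` and `suc q` with p ≤ q. Once the smaller is deleted
-- the larger has index q; once the larger is deleted the smaller still has index p. Either order
-- leaves the same columns.
punchIn-exchange : ∀ {n} (p q : Fin (suc n)) (k : Fin n) → toℕ p ℕ.≤ toℕ q →
  punchIn (inject₁ p) (punchIn q k) ≡ punchIn (suc q) (punchIn p k)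
punchIn-exchange zero    q       k       _         = ≡.refl
punchIn-exchange (suc p) (suc q) zero    _         = ≡.refl
punchIn-exchange (suc p) (suc q) (suc k) (s≤s p≤q) = ≡.cong suc (punchIn-exchange p q k p≤q)

infixl 9 _[_≔_]

_[_≔_] : ∀ {a} {A : Set a} {n} → Matrix A n → Fin n → Vector A n → Matrix A n
M [ i ≔ r ] = updateAt M i (const r)

minor : ∀ {a} {A : Set a} {n} → Matrix A (suc n) → Fin (suc n) → Matrix A n
minor M j i k = M (suc i) (punchIn j k)

minor-≔ : ∀ {a} {A : Set a} {n} (M : Matrix A (suc n)) i r j i′ k →
  minor (M [ suc i ≔ r ]) j i′ k ≡ (minor M j [ i ≔ r ∘ punchIn j ]) i′ k
minor-≔ M i r j i′ k = ≡.cong-app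
  (map-updateAt {f = _∘ punchIn j} {g = const r} {h = const (r ∘ punchIn j)}
    (λ _ → ≡.refl) (tail M) i i′) k

-- Determinants over a commutative ring: linearity, alternation, adjugate.

module DeterminantProperties {c ℓ} (R : CommutativeRing c ℓ) where
  open CommutativeRing R hiding (zero)
  open Determinant rawRing public using (det)
  open import Algebra.Definitions.RawSemiring (RawRing.rawSemiring rawRing) using (_^_)
  open import Algebra.Properties.Semiring.Sum semiring
  open import Algebra.Properties.Ring ring using (-1*x≈-x)
  open import Algebra.Properties.Group +-group using (identityˡ-unique)
  open import Algebra.Solver.Ring.NaturalCoefficients.Default commutativeSemiring
  open import Relation.Binary.Reasoning.Setoid setoid

  δ : ∀ {n} → Matrix Carrier n
  δ i j = if does (i ≟ j) then 1# else 0#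

  sum-zero : ∀ {n} (f : Vector Carrier n) → (∀ i → f i ≈ 0#) → sum f ≈ 0#
  sum-zero {n} f f≈0 = trans (sum-cong-≋ f≈0) (sum-replicate-zero n)

  δ-refl : ∀ {n} (i : Fin n) → δ i i ≈ 1#
  δ-refl i = reflexive (≡.cong (if_then 1# else 0#) (dec-true (i ≟ i) ≡.refl))

  δ-≢ : ∀ {n} {i j : Fin n} → i ≢ j → δ i j ≈ 0#
  δ-≢ {i = i} {j} i≢j = reflexive (≡.cong (if_then 1# else 0#) (dec-false (i ≟ j) i≢j))

  δ-sym : ∀ {n} (i j : Fin n) → δ i j ≈ δ j i
  δ-sym i j with i ≟ j
  ... | yes ≡.refl = sym (δ-refl i)
  ... | no i≢j     = sym (δ-≢ (i≢j ∘ ≡.sym))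

  sum-δ : ∀ {n} (f : Vector Carrier n) l → sum (λ j → f j * δ j l) ≈ f l
  sum-δ f zero = begin
    f zero * 1# + sum (λ j → f (suc j) * 0#)  ≈⟨ +-cong (*-identityʳ _) (sum-zero _ λ j → zeroʳ (f (suc j))) ⟩
    f zero + 0#                               ≈⟨ +-identityʳ _ ⟩
    f zero                                    ∎
  sum-δ f (suc l) = begin
    f zero * 0# + sum (λ j → f (suc j) * δ j l)  ≈⟨ +-cong (zeroʳ _) (sum-δ (f ∘ suc) l) ⟩
    0# + f (suc l)                               ≈⟨ +-identityˡ _ ⟩
    f (suc l)                                    ∎

  sign : ∀ {n} → Fin n → Carrier
  sign j = (- 1#) ^ toℕ j

  det-cong : ∀ {n} {M N : Matrix Carrier n} → (∀ i j → M i j ≈ N i j) → det M ≈ det N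
  det-cong {zero}  M≈N = refl
  det-cong {suc n} M≈N = sum-cong-≋ λ j →
    *-cong (*-congˡ {x = sign j} (M≈N zero j)) (det-cong λ i k → M≈N (suc i) (punchIn j k))

  det-≔-cong : ∀ {n} (M : Matrix Carrier n) i {r r′ : Vector Carrier n} → (∀ k → r k ≈ r′ k) →
    det (M [ i ≔ r ]) ≈ det (M [ i ≔ r′ ])
  det-≔-cong M i {r} {r′} r≈r′ = det-cong λ i′ k → rows M i i′ k
    where
    rows : ∀ {m} (N : Vector (Vector Carrier _) m) i i′ k →
      updateAt N i (const r) i′ k ≈ updateAt N i (const r′) i′ k
    rows N zero    zero     k = r≈r′ k
    rows N zero    (suc i′) k = refl
    rows N (suc i) zero     k = refl
    rows N (suc i) (suc i′) k = rows (tail N) i i′ k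

  det-minor-≔ : ∀ {n} (M : Matrix Carrier (suc n)) i r j →
    det (minor (M [ suc i ≔ r ]) j) ≈ det (minor M j [ i ≔ r ∘ punchIn j ])
  det-minor-≔ M i r j = det-cong λ i′ k → reflexive (minor-≔ M i r j i′ k)

  -- Row 0 enters the expansion through one linear factor; a later row enters only through the
  -- minors, where induction applies.
  det-linear : ∀ {n} (M : Matrix Carrier n) i c (r r′ : Vector Carrier n) →
    det (M [ i ≔ (λ k → c * r k + r′ k) ]) ≈ c * det (M [ i ≔ r ]) + det (M [ i ≔ r′ ])
  det-linear {suc n} M i c r r′ = begin
    sum (λ j → term (combine r r′) j)                         ≈⟨ sum-cong-≋ (termwise i) ⟩
    sum (λ j → c * term r j + term r′ j)                      ≈⟨ ∑-distrib-+ (λ j → c * term r j) (term r′) ⟩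
    sum (λ j → c * term r j) + sum (λ j → term r′ j)          ≈⟨ +-congʳ (*-distribˡ-sum c (term r)) ⟨
    c * sum (λ j → term r j) + sum (λ j → term r′ j)          ∎
    where
    combine : Vector Carrier (suc n) → Vector Carrier (suc n) → Vector Carrier (suc n)
    combine r r′ k = c * r k + r′ k

    termAt : Fin (suc n) → Vector Carrier (suc n) → Vector Carrier (suc n)
    termAt i r j = sign j * (M [ i ≔ r ]) zero j * det (minor (M [ i ≔ r ]) j)

    term : Vector Carrier (suc n) → Vector Carrier (suc n)
    term = termAt i

    termwise : ∀ i j → termAt i (combine r r′) j ≈ c * termAt i r j + termAt i r′ j
    termwise zero j = solve 5 (λ s c x y d →
      s :* (c :* x :+ y) :* d := c :* (s :* x :* d) :+ s :* y :* d) refl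
      (sign j) c (r j) (r′ j) (det (minor M j))
    termwise (suc i) j = begin
      s * det (minor (M [ suc i ≔ combine r r′ ]) j)
        ≈⟨ *-congˡ (det-minor-≔ M i (combine r r′) j) ⟩
      s * det (minor M j [ i ≔ combine r r′ ∘ punchIn j ])
        ≈⟨ *-congˡ (det-linear (minor M j) i c (r ∘ punchIn j) (r′ ∘ punchIn j)) ⟩
      s * (c * det (minor M j [ i ≔ r ∘ punchIn j ]) + det (minor M j [ i ≔ r′ ∘ punchIn j ]))
        ≈⟨ *-congˡ (+-cong (*-congˡ (det-minor-≔ M i r j)) (det-minor-≔ M i r′ j)) ⟨
      s * (c * det (minor (M [ suc i ≔ r ]) j) + det (minor (M [ suc i ≔ r′ ]) j))
        ≈⟨ solve 4 (λ s c x y → s :* (c :* x :+ y) := c :* (s :* x) :+ s :* y) refl s c _ _ ⟩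
      c * (s * det (minor (M [ suc i ≔ r ]) j)) + s * det (minor (M [ suc i ≔ r′ ]) j) ∎
      where s = sign j * M zero j

  det-+ : ∀ {n} (M : Matrix Carrier n) i (r r′ : Vector Carrier n) →
    det (M [ i ≔ (λ k → r k + r′ k) ]) ≈ det (M [ i ≔ r ]) + det (M [ i ≔ r′ ])
  det-+ M i r r′ = begin
    det (M [ i ≔ (λ k → r k + r′ k) ])             ≈⟨ det-≔-cong M i (λ k → +-congʳ (*-identityˡ _)) ⟨
    det (M [ i ≔ (λ k → 1# * r k + r′ k) ])        ≈⟨ det-linear M i 1# r r′ ⟩
    1# * det (M [ i ≔ r ]) + det (M [ i ≔ r′ ])    ≈⟨ +-congʳ (*-identityˡ _) ⟩
    det (M [ i ≔ r ]) + det (M [ i ≔ r′ ])         ∎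

  -- The zero row is the sum of two zero rows, so by additivity the determinant equals its own
  -- double.
  det-zeroRow : ∀ {n} (M : Matrix Carrier n) i → det (M [ i ≔ const 0# ]) ≈ 0#
  det-zeroRow M i = identityˡ-unique _ _
    (trans (sym (det-+ M i (const 0#) (const 0#))) (det-≔-cong M i λ _ → +-identityˡ 0#))

  det-sum : ∀ {m n} (M : Matrix Carrier n) i (c : Vector Carrier m) (r : Vector (Vector Carrier n) m) →
    det (M [ i ≔ (λ k → sum (λ j → c j * r j k)) ]) ≈ sum (λ j → c j * det (M [ i ≔ r j ]))
  det-sum {zero}  M i c r = det-zeroRow M i
  det-sum {suc m} M i c r = begin
    det (M [ i ≔ (λ k → c zero * r zero k + sum (λ j → c (suc j) * r (suc j) k)) ])
      ≈⟨ det-linear M i (c zero) (r zero) _ ⟩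
    c zero * det (M [ i ≔ r zero ]) + det (M [ i ≔ (λ k → sum (λ j → c (suc j) * r (suc j) k)) ])
      ≈⟨ +-congˡ (det-sum M i (c ∘ suc) (r ∘ suc)) ⟩
    c zero * det (M [ i ≔ r zero ]) + sum (λ j → c (suc j) * det (M [ i ≔ r (suc j) ])) ∎

  -- With f j k placed at (j, punchIn j k), the entries at (p, q + 1) and (q + 1, p) cancel.
  sum-antisymmetric : ∀ {n} (f : Fin (suc n) → Fin n → Carrier) →
    (∀ p q → toℕ p ℕ.≤ toℕ q → f (inject₁ p) q + f (suc q) p ≈ 0#) →
    sum (λ j → sum (f j)) ≈ 0#
  sum-antisymmetric {zero}  f anti = +-identityˡ 0#
  sum-antisymmetric {suc n} f anti = begin
    sum (f zero) + sum (λ j → f (suc j) zero + sum (λ k → f (suc j) (suc k)))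
      ≈⟨ +-congˡ (∑-distrib-+ (λ j → f (suc j) zero) (λ j → sum (λ k → f (suc j) (suc k)))) ⟩
    sum (f zero) + (sum (λ j → f (suc j) zero) + sum (λ j → sum (λ k → f (suc j) (suc k))))
      ≈⟨ +-assoc _ _ _ ⟨
    sum (f zero) + sum (λ j → f (suc j) zero) + sum (λ j → sum (λ k → f (suc j) (suc k)))
      ≈⟨ +-cong (sym (∑-distrib-+ (f zero) (λ j → f (suc j) zero)))
           (sum-antisymmetric (λ j k → f (suc j) (suc k)) λ p q p≤q → anti (suc p) (suc q) (s≤s p≤q)) ⟩
    sum (λ j → f zero j + f (suc j) zero) + 0#
      ≈⟨ +-identityʳ _ ⟩
    sum (λ j → f zero j + f (suc j) zero)
      ≈⟨ sum-zero _ (λ j → anti zero j z≤n) ⟩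
    0# ∎

  -- Expanding along both rows gives a sum over ordered pairs of distinct columns. Exchanging the
  -- two columns keeps the entries and the remaining minor, since the rows agree, but shifts one
  -- exponent of -1 by one.
  det-equalRows₀₁ : ∀ {n} (M : Matrix Carrier (suc (suc n))) →
    (∀ k → M zero k ≈ M (suc zero) k) → det M ≈ 0#
  det-equalRows₀₁ {n} M M₀≈M₁ = begin
    det M                    ≈⟨ sum-cong-≋ (λ j → *-distribˡ-sum (sign j * r j) (λ k → sign k * M (suc zero) (punchIn j k) * d j k)) ⟩
    sum (λ j → sum (f j))    ≈⟨ sum-antisymmetric f anti ⟩
    0#                       ∎
    where
    r = M zero

    d : Fin (suc (suc n)) → Fin (suc n) → Carrier
    d j k = det (minor (minor M j) k)

    f : Fin (suc (suc n)) → Fin (suc n) → Carrier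
    f j k = sign j * r j * (sign k * M (suc zero) (punchIn j k) * d j k)

    common : Fin (suc n) → Fin (suc n) → Carrier
    common p q = sign p * r (inject₁ p) * (sign q * r (suc q) * d (suc q) p)

    left : ∀ p q → toℕ p ℕ.≤ toℕ q → f (inject₁ p) q ≈ common p q
    left p q p≤q = *-cong
      (*-congʳ (reflexive (≡.cong ((- 1#) ^_) (toℕ-inject₁ p))))
      (*-cong
        (*-congˡ (trans (sym (M₀≈M₁ _)) (reflexive (≡.cong r (punchIn-inject₁ p q p≤q)))))
        (det-cong λ a b → reflexive (≡.cong (M (suc (suc a))) (punchIn-exchange p q b p≤q))))

    right : ∀ p q → toℕ p ℕ.≤ toℕ q → f (suc q) p ≈ - common p q
    right p q p≤q = begin
      - 1# * sign q * r (suc q) * (sign p * M (suc zero) (punchIn (suc q) p) * d (suc q) p)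
        ≈⟨ *-congˡ (*-congʳ (*-congˡ (trans (sym (M₀≈M₁ _)) (reflexive (≡.cong r (punchIn-suc p q p≤q)))))) ⟩
      - 1# * sign q * r (suc q) * (sign p * r (inject₁ p) * d (suc q) p)
        ≈⟨ solve 6 (λ e s t x y z → e :* t :* y :* (s :* x :* z) := e :* (s :* x :* (t :* y :* z))) refl
             (- 1#) (sign p) (sign q) (r (inject₁ p)) (r (suc q)) (d (suc q) p) ⟩
      - 1# * common p q
        ≈⟨ -1*x≈-x _ ⟩
      - common p q ∎

    anti : ∀ p q → toℕ p ℕ.≤ toℕ q → f (inject₁ p) q + f (suc q) p ≈ 0#
    anti p q p≤q = trans (+-cong (left p q p≤q) (right p q p≤q)) (-‿inverseʳ _)

  -- A predicate of the size, so that the induction hypothesis can be handed to the reduction lemmas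
  -- below.
  Alternating : ℕ → Set _
  Alternating n = ∀ (M : Matrix Carrier n) i k → i ≢ k → (∀ j → M i j ≈ M k j) → det M ≈ 0#

  det-equalTailRows : ∀ {n} → Alternating n → ∀ (M : Matrix Carrier (suc n)) i k → i ≢ k →
    (∀ j → M (suc i) j ≈ M (suc k) j) → det M ≈ 0#
  det-equalTailRows alt M i k i≢k Mᵢ≈Mₖ = sum-zero _ λ j →
    trans (*-congˡ {x = sign j * M zero j} (alt (minor M j) i k i≢k λ l → Mᵢ≈Mₖ (punchIn j l))) (zeroʳ _)

  -- If rows 0 and k + 2 are both a and row 1 is b, then putting a + b in rows 1 and k + 2
  -- gives 0 and, by bilinearity, also the sum of the determinant in question and three
  -- determinants which vanish.
  det-equalRows₀₊₂ : ∀ {n} → Alternating (suc n) → ∀ (M : Matrix Carrier (suc (suc n))) k →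
    (∀ j → M zero j ≈ M (suc (suc k)) j) → det M ≈ 0#
  det-equalRows₀₊₂ {n} alt M k M₀≈Mₖ = begin
    det M                  ≈⟨ det-cong unchanged ⟩
    g b a                  ≈⟨ +-identityʳ _ ⟨
    g b a + 0#             ≈⟨ +-congˡ (g-diagonal b) ⟨
    g b a + g b b          ≈⟨ det-+ (M [ suc zero ≔ b ]) (suc (suc k)) a b ⟨
    g b a+b                ≈⟨ +-identityˡ _ ⟨
    0# + g b a+b           ≈⟨ +-congʳ (g-first a+b) ⟨
    g a a+b + g b a+b      ≈⟨ g-+ˡ a+b ⟨
    g a+b a+b              ≈⟨ g-diagonal a+b ⟩
    0#                     ∎
    where
    a = M zero
    b = M (suc zero)

    a+b : Vector Carrier (suc (suc n))
    a+b j = a j + b j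

    g : Vector Carrier (suc (suc n)) → Vector Carrier (suc (suc n)) → Carrier
    g x y = det (M [ suc zero ≔ x ] [ suc (suc k) ≔ y ])

    g-diagonal : ∀ x → g x x ≈ 0#
    g-diagonal x = det-equalTailRows alt (M [ suc zero ≔ x ] [ suc (suc k) ≔ x ]) zero (suc k) (λ ())
      λ j → reflexive (≡.cong-app (≡.sym (updateAt-updates k (tail (tail M)))) j)

    g-first : ∀ y → g a y ≈ 0#
    g-first y = det-equalRows₀₁ (M [ suc zero ≔ a ] [ suc (suc k) ≔ y ]) λ _ → refl

    exchange : ∀ x y i j →
      (M [ suc zero ≔ x ] [ suc (suc k) ≔ y ]) i j ≈ (M [ suc (suc k) ≔ y ] [ suc zero ≔ x ]) i j
    exchange x y zero          j = refl
    exchange x y (suc zero)    j = refl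
    exchange x y (suc (suc i)) j = refl

    g-+ˡ : ∀ y → g a+b y ≈ g a y + g b y
    g-+ˡ y = begin
      g a+b y              ≈⟨ det-cong (exchange a+b y) ⟩
      det (M [ suc (suc k) ≔ y ] [ suc zero ≔ a+b ])
                           ≈⟨ det-+ (M [ suc (suc k) ≔ y ]) (suc zero) a b ⟩
      det (M [ suc (suc k) ≔ y ] [ suc zero ≔ a ]) + det (M [ suc (suc k) ≔ y ] [ suc zero ≔ b ])
                           ≈⟨ +-cong (det-cong (exchange a y)) (det-cong (exchange b y)) ⟨
      g a y + g b y        ∎

    unchanged : ∀ i j → M i j ≈ (M [ suc zero ≔ b ] [ suc (suc k) ≔ a ]) i j
    unchanged zero          j = refl
    unchanged (suc zero)    j = refl
    unchanged (suc (suc i)) j with i ≟ k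
    ... | yes ≡.refl = trans (sym (M₀≈Mₖ j)) (reflexive (≡.cong-app (≡.sym (updateAt-updates k (tail (tail M)))) j))
    ... | no i≢k     = reflexive (≡.cong-app (≡.sym (updateAt-minimal i k (tail (tail M)) i≢k)) j)

  -- Two rows below the first survive in every minor. A pair containing row 0 is either rows 0 and
  -- 1, settled by the double expansion, or is reduced by bilinearity to pairs already treated.
  det-equalRows : ∀ {n} → Alternating n
  det-equalRows {suc n}       M zero          zero          0≢0 _     = contradiction ≡.refl 0≢0
  det-equalRows {suc (suc n)} M zero          (suc zero)    _   Mᵢ≈Mₖ = det-equalRows₀₁ M Mᵢ≈Mₖ
  det-equalRows {suc (suc n)} M zero          (suc (suc k)) _   Mᵢ≈Mₖ = det-equalRows₀₊₂ det-equalRows M k Mᵢ≈Mₖ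
  det-equalRows {suc (suc n)} M (suc zero)    zero          _   Mᵢ≈Mₖ = det-equalRows₀₁ M (λ j → sym (Mᵢ≈Mₖ j))
  det-equalRows {suc (suc n)} M (suc (suc i)) zero          _   Mᵢ≈Mₖ = det-equalRows₀₊₂ det-equalRows M i (λ j → sym (Mᵢ≈Mₖ j))
  det-equalRows {suc n}       M (suc i)       (suc k)       i≢k Mᵢ≈Mₖ =
    det-equalTailRows det-equalRows M i k (i≢k ∘ ≡.cong suc) Mᵢ≈Mₖ

  -- The (i, j) cofactor, written as a determinant of full size.
  adjugate : ∀ {n} → Matrix Carrier n → Matrix Carrier n
  adjugate M j i = det (M [ i ≔ δ j ])

  -- By linearity in row i the sum is the determinant of M with row k copied into row i: this is M
  -- itself if k = i, and has two equal rows otherwise.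
  *-adjugate : ∀ {n} (M : Matrix Carrier n) k i →
    sum (λ j → M k j * adjugate M j i) ≈ δ k i * det M
  *-adjugate M k i = trans (sym (det-sum M i (M k) δ)) (trans (det-≔-cong M i (sum-δ (M k))) (row-duplicated k i))
    where
    row-duplicated : ∀ k i → det (M [ i ≔ M k ]) ≈ δ k i * det M
    row-duplicated k i with k ≟ i
    ... | yes ≡.refl = trans
      (det-cong λ i′ j → reflexive (≡.cong-app (updateAt-id-local k M ≡.refl i′) j))
      (sym (*-identityˡ _))
    ... | no k≢i = trans
      (det-equalRows (M [ i ≔ M k ]) k i k≢i λ j → reflexive (≡.cong-app
        (≡.trans (updateAt-minimal k i M k≢i) (≡.sym (updateAt-updates i M))) j))
      (sym (zeroˡ _))

  det-δ : ∀ {n} → det (δ {n}) ≈ 1#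
  det-δ {zero}  = refl
  det-δ {suc n} = begin
    1# * 1# * det (δ {n}) + sum f
      ≈⟨ +-cong (trans (*-congʳ (*-identityˡ 1#)) (*-identityˡ _))
           (sum-zero f λ j → trans (*-congʳ (zeroʳ (sign (suc j)))) (zeroˡ _)) ⟩
    det (δ {n}) + 0#
      ≈⟨ +-identityʳ _ ⟩
    det (δ {n})
      ≈⟨ det-δ {n} ⟩
    1# ∎
    where
    f : Vector Carrier n
    f j = sign (suc j) * 0# * det (minor δ (suc j))

  -- Differentiating a determinant.

  module Derivation
    (D : Carrier → Carrier)
    (D-cong : ∀ {x y} → x ≈ y → D x ≈ D y)
    (D-+ : ∀ x y → D (x + y) ≈ D x + D y)
    (D-* : ∀ x y → D (x * y) ≈ D x * y + x * D y)
    where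

    D-0# : D 0# ≈ 0#
    D-0# = identityˡ-unique _ _ (trans (sym (D-+ 0# 0#)) (D-cong (+-identityˡ 0#)))

    D-1# : D 1# ≈ 0#
    D-1# = identityˡ-unique _ _ (begin
      D 1# + D 1#            ≈⟨ +-cong (*-identityʳ _) (*-identityˡ _) ⟨
      D 1# * 1# + 1# * D 1#  ≈⟨ D-* 1# 1# ⟨
      D (1# * 1#)            ≈⟨ D-cong (*-identityˡ 1#) ⟩
      D 1#                   ∎)

    -- Together with `D-^` this makes the signs of the Laplace expansion constants for D.
    D--1# : D (- 1#) ≈ 0#
    D--1# = begin
      D (- 1#)           ≈⟨ +-identityʳ _ ⟨
      D (- 1#) + 0#      ≈⟨ +-congˡ D-1# ⟨
      D (- 1#) + D 1#    ≈⟨ D-+ (- 1#) 1# ⟨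
      D (- 1# + 1#)      ≈⟨ D-cong (-‿inverseˡ 1#) ⟩
      D 0#               ≈⟨ D-0# ⟩
      0#                 ∎

    D-^ : ∀ {x} → D x ≈ 0# → ∀ k → D (x ^ k) ≈ 0#
    D-^ {x} Dx≈0 zero    = D-1#
    D-^ {x} Dx≈0 (suc k) = begin
      D (x * x ^ k)                ≈⟨ D-* x (x ^ k) ⟩
      D x * x ^ k + x * D (x ^ k)  ≈⟨ +-cong (*-congʳ Dx≈0) (*-congˡ (D-^ Dx≈0 k)) ⟩
      0# * x ^ k + x * 0#          ≈⟨ +-cong (zeroˡ _) (zeroʳ _) ⟩
      0# + 0#                      ≈⟨ +-identityˡ 0# ⟩
      0#                           ∎

    D-sum : ∀ {n} (f : Vector Carrier n) → D (sum f) ≈ sum (D ∘ f)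
    D-sum {zero}  f = D-0#
    D-sum {suc n} f = trans (D-+ (f zero) _) (+-congˡ (D-sum (f ∘ suc)))

    -- Leibniz rule on each term of the expansion: differentiating the entry of row 0 yields the
    -- summand for that row, differentiating the minor yields the others by induction, after
    -- interchanging the sums over rows and columns.
    D-det : ∀ {n} (M : Matrix Carrier n) → D (det M) ≈ sum (λ i → det (M [ i ≔ D ∘ M i ]))
    D-det {zero}  M = D-1#
    D-det {suc n} M = begin
      D (sum (λ j → sign j * M zero j * d j))
        ≈⟨ D-sum (λ j → sign j * M zero j * d j) ⟩
      sum (λ j → D (sign j * M zero j * d j))
        ≈⟨ sum-cong-≋ termwise ⟩
      sum (λ j → sign j * D (M zero j) * d j + sum (λ i → h i j))
        ≈⟨ ∑-distrib-+ (λ j → sign j * D (M zero j) * d j) (λ j → sum (λ i → h i j)) ⟩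
      det (M [ zero ≔ D ∘ M zero ]) + sum (λ j → sum (λ i → h i j))
        ≈⟨ +-congˡ (∑-comm (λ j i → h i j)) ⟩
      det (M [ zero ≔ D ∘ M zero ]) + sum (λ i → det (M [ suc i ≔ D ∘ M (suc i) ])) ∎
      where
      d : Fin (suc n) → Carrier
      d j = det (minor M j)

      h : Fin n → Fin (suc n) → Carrier
      h i j = sign j * M zero j * det (minor (M [ suc i ≔ D ∘ M (suc i) ]) j)

      termwise : ∀ j → D (sign j * M zero j * d j) ≈ sign j * D (M zero j) * d j + sum (λ i → h i j)
      termwise j = begin
        D (sign j * M zero j * d j)
          ≈⟨ D-* _ _ ⟩
        D (sign j * M zero j) * d j + sign j * M zero j * D (d j)
          ≈⟨ +-cong
               (*-congʳ (trans (D-* _ _) (trans (+-congʳ (trans (*-congʳ (D-^ D--1# (toℕ j))) (zeroˡ _))) (+-identityˡ _))))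
               (*-congˡ (D-det (minor M j))) ⟩
        sign j * D (M zero j) * d j + sign j * M zero j * sum (λ i → det (minor M j [ i ≔ D ∘ minor M j i ]))
          ≈⟨ +-congˡ (*-distribˡ-sum (sign j * M zero j) (λ i → det (minor M j [ i ≔ D ∘ minor M j i ]))) ⟩
        sign j * D (M zero j) * d j + sum (λ i → sign j * M zero j * det (minor M j [ i ≔ D ∘ minor M j i ]))
          ≈⟨ +-congˡ (sum-cong-≋ λ i → *-congˡ {x = sign j * M zero j} (det-minor-≔ M i (D ∘ M (suc i)) j)) ⟨
        sign j * D (M zero j) * d j + sum (λ i → h i j) ∎

-- The polynomial ring and the formal derivative.

module PolynomialRing {c ℓ} (R : CommutativeRing c ℓ) where
  open CommutativeRing R hiding (zero)
  open Polynomial rawRing public hiding (const)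
  open RawRing polyRawRing public using () renaming (_≈_ to _≈ᵖ_)
  open import Algebra.Properties.Ring ring using (-0#≈0#)
  open import Algebra.Properties.CommutativeMonoid.Mult +-commutativeMonoid using (×-congʳ; ×-distrib-+) renaming (_×_ to _·_)
  open import Algebra.Properties.Semiring.Mult semiring using (×-comm-*)
  open import Algebra.Solver.Ring.NaturalCoefficients.Default commutativeSemiring
  open import Relation.Binary.Reasoning.Setoid setoid

  -- Multiplication by X on coefficient sequences. Equality of polynomials ignores trailing zeros,
  -- so all laws are proved coefficient by coefficient.
  shift : (ℕ → Carrier) → ℕ → Carrier
  shift f zero    = 0#
  shift f (suc k) = f k

  shift-cong : ∀ {f g} → (∀ k → f k ≈ g k) → ∀ k → shift f k ≈ shift g k
  shift-cong f≈g zero    = refl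
  shift-cong f≈g (suc k) = f≈g k

  shift-zero : ∀ {f} → (∀ k → f k ≈ 0#) → ∀ k → shift f k ≈ 0#
  shift-zero f≈0 zero    = refl
  shift-zero f≈0 (suc k) = f≈0 k

  shift-+ : ∀ f g k → shift (λ m → f m + g m) k ≈ shift f k + shift g k
  shift-+ f g zero    = sym (+-identityˡ 0#)
  shift-+ f g (suc k) = refl

  shift-* : ∀ a f k → shift (λ m → a * f m) k ≈ a * shift f k
  shift-* a f zero    = sym (zeroʳ a)
  shift-* a f (suc k) = refl

  coeff-0∷ : ∀ p k → coeff (0# ∷ p) k ≈ shift (coeff p) k
  coeff-0∷ p zero    = refl
  coeff-0∷ p (suc k) = refl

  coeff-+ : ∀ p q k → coeff (p +ᵖ q) k ≈ coeff p k + coeff q k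
  coeff-+ []      q       k       = sym (+-identityˡ _)
  coeff-+ (a ∷ p) []      k       = sym (+-identityʳ _)
  coeff-+ (a ∷ p) (b ∷ q) zero    = refl
  coeff-+ (a ∷ p) (b ∷ q) (suc k) = coeff-+ p q k

  coeff-scale : ∀ a p k → coeff (map (a *_) p) k ≈ a * coeff p k
  coeff-scale a []      k       = sym (zeroʳ a)
  coeff-scale a (b ∷ p) zero    = refl
  coeff-scale a (b ∷ p) (suc k) = coeff-scale a p k

  coeff-neg : ∀ p k → coeff (map -_ p) k ≈ - coeff p k
  coeff-neg []      k       = sym -0#≈0#
  coeff-neg (b ∷ p) zero    = refl
  coeff-neg (b ∷ p) (suc k) = coeff-neg p k

  coeff-∷-* : ∀ a p q k → coeff ((a ∷ p) *ᵖ q) k ≈ a * coeff q k + shift (coeff (p *ᵖ q)) k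
  coeff-∷-* a p q k = trans (coeff-+ (map (a *_) q) _ k) (+-cong (coeff-scale a q k) (coeff-0∷ (p *ᵖ q) k))

  +ᵖ-cong : ∀ {p p′ q q′} → p ≈ᵖ p′ → q ≈ᵖ q′ → p +ᵖ q ≈ᵖ p′ +ᵖ q′
  +ᵖ-cong {p} {p′} {q} {q′} p≈p′ q≈q′ k =
    trans (coeff-+ p q k) (trans (+-cong (p≈p′ k) (q≈q′ k)) (sym (coeff-+ p′ q′ k)))

  *ᵖ-congˡ : ∀ p {q q′} → q ≈ᵖ q′ → p *ᵖ q ≈ᵖ p *ᵖ q′
  *ᵖ-congˡ []      q≈q′ k = refl
  *ᵖ-congˡ (a ∷ p) {q} {q′} q≈q′ k = begin
    coeff ((a ∷ p) *ᵖ q) k                         ≈⟨ coeff-∷-* a p q k ⟩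
    a * coeff q k + shift (coeff (p *ᵖ q)) k       ≈⟨ +-cong (*-congˡ (q≈q′ k)) (shift-cong (*ᵖ-congˡ p q≈q′) k) ⟩
    a * coeff q′ k + shift (coeff (p *ᵖ q′)) k     ≈⟨ coeff-∷-* a p q′ k ⟨
    coeff ((a ∷ p) *ᵖ q′) k                        ∎

  *ᵖ-zeroʳ : ∀ p → p *ᵖ [] ≈ᵖ []
  *ᵖ-zeroʳ []      k = refl
  *ᵖ-zeroʳ (a ∷ p) k = trans (coeff-0∷ (p *ᵖ []) k) (shift-zero (*ᵖ-zeroʳ p) k)

  -- Multiplication is defined by recursion on its left factor; this mirror recursion on the right
  -- factor is what yields commutativity.
  coeff-*-∷ : ∀ p b q k → coeff (p *ᵖ (b ∷ q)) k ≈ b * coeff p k + shift (coeff (p *ᵖ q)) k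
  coeff-*-∷ []      b q k = sym (trans (+-cong (zeroʳ b) (shift-zero (λ _ → refl) k)) (+-identityˡ 0#))
  coeff-*-∷ (a ∷ p) b q zero = begin
    coeff ((a ∷ p) *ᵖ (b ∷ q)) zero  ≈⟨ coeff-∷-* a p (b ∷ q) zero ⟩
    a * b + 0#                       ≈⟨ +-congʳ (*-comm a b) ⟩
    b * a + 0#                       ∎
  coeff-*-∷ (a ∷ p) b q (suc k) = begin
    coeff ((a ∷ p) *ᵖ (b ∷ q)) (suc k)                               ≈⟨ coeff-∷-* a p (b ∷ q) (suc k) ⟩
    a * coeff q k + coeff (p *ᵖ (b ∷ q)) k                           ≈⟨ +-congˡ (coeff-*-∷ p b q k) ⟩
    a * coeff q k + (b * coeff p k + shift (coeff (p *ᵖ q)) k)       ≈⟨ solve 3 (λ x y z → x :+ (y :+ z) := y :+ (x :+ z)) refl _ _ _ ⟩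
    b * coeff p k + (a * coeff q k + shift (coeff (p *ᵖ q)) k)       ≈⟨ +-congˡ (coeff-∷-* a p q k) ⟨
    b * coeff p k + coeff ((a ∷ p) *ᵖ q) k                           ∎

  *ᵖ-comm : ∀ p q → p *ᵖ q ≈ᵖ q *ᵖ p
  *ᵖ-comm []      q k = sym (*ᵖ-zeroʳ q k)
  *ᵖ-comm (a ∷ p) q k = begin
    coeff ((a ∷ p) *ᵖ q) k                       ≈⟨ coeff-∷-* a p q k ⟩
    a * coeff q k + shift (coeff (p *ᵖ q)) k     ≈⟨ +-congˡ (shift-cong (*ᵖ-comm p q) k) ⟩
    a * coeff q k + shift (coeff (q *ᵖ p)) k     ≈⟨ coeff-*-∷ q a p k ⟨
    coeff (q *ᵖ (a ∷ p)) k                       ∎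

  *ᵖ-cong : ∀ {p p′ q q′} → p ≈ᵖ p′ → q ≈ᵖ q′ → p *ᵖ q ≈ᵖ p′ *ᵖ q′
  *ᵖ-cong {p} {p′} {q} {q′} p≈p′ q≈q′ k = begin
    coeff (p *ᵖ q) k      ≈⟨ *ᵖ-congˡ p q≈q′ k ⟩
    coeff (p *ᵖ q′) k     ≈⟨ *ᵖ-comm p q′ k ⟩
    coeff (q′ *ᵖ p) k     ≈⟨ *ᵖ-congˡ q′ p≈p′ k ⟩
    coeff (q′ *ᵖ p′) k    ≈⟨ *ᵖ-comm q′ p′ k ⟩
    coeff (p′ *ᵖ q′) k    ∎

  *ᵖ-distribˡ-+ᵖ : ∀ p q r → p *ᵖ (q +ᵖ r) ≈ᵖ p *ᵖ q +ᵖ p *ᵖ r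
  *ᵖ-distribˡ-+ᵖ []      q r k = refl
  *ᵖ-distribˡ-+ᵖ (a ∷ p) q r k = begin
    coeff ((a ∷ p) *ᵖ (q +ᵖ r)) k
      ≈⟨ coeff-∷-* a p (q +ᵖ r) k ⟩
    a * coeff (q +ᵖ r) k + shift (coeff (p *ᵖ (q +ᵖ r))) k
      ≈⟨ +-cong (*-congˡ (coeff-+ q r k))
           (shift-cong (λ m → trans (*ᵖ-distribˡ-+ᵖ p q r m) (coeff-+ (p *ᵖ q) (p *ᵖ r) m)) k) ⟩
    a * (coeff q k + coeff r k) + shift (λ m → coeff (p *ᵖ q) m + coeff (p *ᵖ r) m) k
      ≈⟨ +-congˡ (shift-+ (coeff (p *ᵖ q)) (coeff (p *ᵖ r)) k) ⟩
    a * (coeff q k + coeff r k) + (shift (coeff (p *ᵖ q)) k + shift (coeff (p *ᵖ r)) k)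
      ≈⟨ solve 5 (λ a x y z w → a :* (x :+ y) :+ (z :+ w) := a :* x :+ z :+ (a :* y :+ w)) refl a _ _ _ _ ⟩
    a * coeff q k + shift (coeff (p *ᵖ q)) k + (a * coeff r k + shift (coeff (p *ᵖ r)) k)
      ≈⟨ +-cong (coeff-∷-* a p q k) (coeff-∷-* a p r k) ⟨
    coeff ((a ∷ p) *ᵖ q) k + coeff ((a ∷ p) *ᵖ r) k
      ≈⟨ coeff-+ ((a ∷ p) *ᵖ q) ((a ∷ p) *ᵖ r) k ⟨
    coeff ((a ∷ p) *ᵖ q +ᵖ (a ∷ p) *ᵖ r) k ∎

  *ᵖ-distribʳ-+ᵖ : ∀ r p q → (p +ᵖ q) *ᵖ r ≈ᵖ p *ᵖ r +ᵖ q *ᵖ r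
  *ᵖ-distribʳ-+ᵖ r p q k = begin
    coeff ((p +ᵖ q) *ᵖ r) k                ≈⟨ *ᵖ-comm (p +ᵖ q) r k ⟩
    coeff (r *ᵖ (p +ᵖ q)) k                ≈⟨ *ᵖ-distribˡ-+ᵖ r p q k ⟩
    coeff (r *ᵖ p +ᵖ r *ᵖ q) k             ≈⟨ +ᵖ-cong {r *ᵖ p} {p *ᵖ r} (*ᵖ-comm r p) (*ᵖ-comm r q) k ⟩
    coeff (p *ᵖ r +ᵖ q *ᵖ r) k             ∎

  scale-*ᵖ : ∀ a p q k → coeff (map (a *_) p *ᵖ q) k ≈ a * coeff (p *ᵖ q) k
  scale-*ᵖ a []      q k = sym (zeroʳ a)
  scale-*ᵖ a (b ∷ p) q k = begin
    coeff ((a * b ∷ map (a *_) p) *ᵖ q) k                        ≈⟨ coeff-∷-* (a * b) (map (a *_) p) q k ⟩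
    a * b * coeff q k + shift (coeff (map (a *_) p *ᵖ q)) k      ≈⟨ +-cong (*-assoc a b _)
                                                                      (trans (shift-cong (scale-*ᵖ a p q) k) (shift-* a (coeff (p *ᵖ q)) k)) ⟩
    a * (b * coeff q k) + a * shift (coeff (p *ᵖ q)) k           ≈⟨ distribˡ a _ _ ⟨
    a * (b * coeff q k + shift (coeff (p *ᵖ q)) k)               ≈⟨ *-congˡ (coeff-∷-* b p q k) ⟨
    a * coeff ((b ∷ p) *ᵖ q) k                                   ∎

  coeff-0∷-* : ∀ p q k → coeff ((0# ∷ p) *ᵖ q) k ≈ shift (coeff (p *ᵖ q)) k
  coeff-0∷-* p q k = trans (coeff-∷-* 0# p q k) (trans (+-congʳ (zeroˡ _)) (+-identityˡ _))

  *ᵖ-assoc : ∀ p q r → (p *ᵖ q) *ᵖ r ≈ᵖ p *ᵖ (q *ᵖ r)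
  *ᵖ-assoc []      q r k = refl
  *ᵖ-assoc (a ∷ p) q r k = begin
    coeff ((map (a *_) q +ᵖ (0# ∷ p *ᵖ q)) *ᵖ r) k
      ≈⟨ *ᵖ-distribʳ-+ᵖ r (map (a *_) q) (0# ∷ p *ᵖ q) k ⟩
    coeff (map (a *_) q *ᵖ r +ᵖ (0# ∷ p *ᵖ q) *ᵖ r) k
      ≈⟨ coeff-+ (map (a *_) q *ᵖ r) _ k ⟩
    coeff (map (a *_) q *ᵖ r) k + coeff ((0# ∷ p *ᵖ q) *ᵖ r) k
      ≈⟨ +-cong (scale-*ᵖ a q r k) (trans (coeff-0∷-* (p *ᵖ q) r k) (shift-cong (*ᵖ-assoc p q r) k)) ⟩
    a * coeff (q *ᵖ r) k + shift (coeff (p *ᵖ (q *ᵖ r))) k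
      ≈⟨ coeff-∷-* a p (q *ᵖ r) k ⟨
    coeff ((a ∷ p) *ᵖ (q *ᵖ r)) k ∎

  *ᵖ-identityˡ : ∀ p → (1# ∷ []) *ᵖ p ≈ᵖ p
  *ᵖ-identityˡ p k = trans (coeff-∷-* 1# [] p k)
    (trans (+-cong (*-identityˡ _) (shift-zero (λ _ → refl) k)) (+-identityʳ _))

  +ᵖ-comm : ∀ p q → p +ᵖ q ≈ᵖ q +ᵖ p
  +ᵖ-comm p q k = trans (coeff-+ p q k) (trans (+-comm _ _) (sym (coeff-+ q p k)))

  +ᵖ-assoc : ∀ p q r → (p +ᵖ q) +ᵖ r ≈ᵖ p +ᵖ (q +ᵖ r)
  +ᵖ-assoc p q r k = begin
    coeff (p +ᵖ q +ᵖ r) k                     ≈⟨ coeff-+ (p +ᵖ q) r k ⟩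
    coeff (p +ᵖ q) k + coeff r k              ≈⟨ +-congʳ (coeff-+ p q k) ⟩
    coeff p k + coeff q k + coeff r k         ≈⟨ +-assoc _ _ _ ⟩
    coeff p k + (coeff q k + coeff r k)       ≈⟨ +-congˡ (coeff-+ q r k) ⟨
    coeff p k + coeff (q +ᵖ r) k              ≈⟨ coeff-+ p (q +ᵖ r) k ⟨
    coeff (p +ᵖ (q +ᵖ r)) k                   ∎

  +ᵖ-inverseˡ : ∀ p → map -_ p +ᵖ p ≈ᵖ []
  +ᵖ-inverseˡ p k = trans (coeff-+ (map -_ p) p k) (trans (+-congʳ (coeff-neg p k)) (-‿inverseˡ _))

  polyRing : CommutativeRing c ℓ
  polyRing = record
    { RawRing polyRawRing
    ; isCommutativeRing = record
      { isRing = record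
        { +-isAbelianGroup = record
          { isGroup = record
            { isMonoid = record
              { isSemigroup = record
                { isMagma = record
                  { isEquivalence = record
                    { refl  = λ _ → refl
                    ; sym   = λ p≈q k → sym (p≈q k)
                    ; trans = λ p≈q q≈r k → trans (p≈q k) (q≈r k)
                    }
                  ; ∙-cong = λ {p} {p′} {q} {q′} → +ᵖ-cong {p} {p′} {q} {q′}
                  }
                ; assoc = +ᵖ-assoc
                }
              ; identity = (λ _ _ → refl) , λ p k → trans (+ᵖ-comm p [] k) refl
              }
            ; inverse = +ᵖ-inverseˡ , λ p k → trans (+ᵖ-comm p (map -_ p) k) (+ᵖ-inverseˡ p k)
            ; ⁻¹-cong = λ {p} {q} p≈q k → trans (coeff-neg p k) (trans (-‿cong (p≈q k)) (sym (coeff-neg q k)))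
            }
          ; comm = +ᵖ-comm
          }
        ; *-cong = λ {p} {p′} {q} {q′} → *ᵖ-cong {p} {p′} {q} {q′}
        ; *-assoc = *ᵖ-assoc
        ; *-identity = *ᵖ-identityˡ , λ p k → trans (*ᵖ-comm p (1# ∷ []) k) (*ᵖ-identityˡ p k)
        ; distrib = *ᵖ-distribˡ-+ᵖ , *ᵖ-distribʳ-+ᵖ
        }
      ; *-comm = *ᵖ-comm
      }
    }

  -- The product rule for a + X p, namely p + X p′, so no integer multiples occur in the definition.
  derivative : Poly → Poly
  derivative []      = []
  derivative (a ∷ p) = p +ᵖ (0# ∷ derivative p)

  coeff-derivative : ∀ p k → coeff (derivative p) k ≈ suc k · coeff p (suc k)
  coeff-derivative []      k       = sym (trans (+-identityˡ _) (·-zero k))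
    where
    ·-zero : ∀ k → k · 0# ≈ 0#
    ·-zero zero    = refl
    ·-zero (suc k) = trans (+-identityˡ _) (·-zero k)
  coeff-derivative (a ∷ p) zero    = coeff-+ p _ zero
  coeff-derivative (a ∷ p) (suc k) = trans (coeff-+ p _ (suc k)) (+-congˡ (coeff-derivative p k))

  -- The operator X d/dX keeps the index of the coefficient, including k = 0. In this form
  -- derivatives enter Newton's identities.
  shift-derivative : ∀ p k → shift (coeff (derivative p)) k ≈ k · coeff p k
  shift-derivative p zero    = refl
  shift-derivative p (suc k) = coeff-derivative p k

  derivative-cong : ∀ {p q} → p ≈ᵖ q → derivative p ≈ᵖ derivative q
  derivative-cong {p} {q} p≈q k =
    trans (coeff-derivative p k) (trans (×-congʳ (suc k) (p≈q (suc k))) (sym (coeff-derivative q k)))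

  derivative-+ : ∀ p q → derivative (p +ᵖ q) ≈ᵖ derivative p +ᵖ derivative q
  derivative-+ p q k = begin
    coeff (derivative (p +ᵖ q)) k                              ≈⟨ coeff-derivative (p +ᵖ q) k ⟩
    suc k · coeff (p +ᵖ q) (suc k)                             ≈⟨ ×-congʳ (suc k) (coeff-+ p q (suc k)) ⟩
    suc k · (coeff p (suc k) + coeff q (suc k))                ≈⟨ ×-distrib-+ _ _ (suc k) ⟩
    suc k · coeff p (suc k) + suc k · coeff q (suc k)          ≈⟨ +-cong (coeff-derivative p k) (coeff-derivative q k) ⟨
    coeff (derivative p) k + coeff (derivative q) k            ≈⟨ coeff-+ (derivative p) (derivative q) k ⟨
    coeff (derivative p +ᵖ derivative q) k                     ∎

  derivative-* : ∀ p q → derivative (p *ᵖ q) ≈ᵖ derivative p *ᵖ q +ᵖ p *ᵖ derivative q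
  derivative-* []      q k = refl
  derivative-* (a ∷ p) q k = begin
    coeff (derivative ((a ∷ p) *ᵖ q)) k
      ≈⟨ coeff-derivative ((a ∷ p) *ᵖ q) k ⟩
    suc k · coeff ((a ∷ p) *ᵖ q) (suc k)
      ≈⟨ ×-congʳ (suc k) (coeff-∷-* a p q (suc k)) ⟩
    suc k · (a * coeff q (suc k) + coeff (p *ᵖ q) k)
      ≈⟨ ×-distrib-+ _ _ (suc k) ⟩
    suc k · (a * coeff q (suc k)) + (coeff (p *ᵖ q) k + k · coeff (p *ᵖ q) k)
      ≈⟨ +-cong (trans (*-congˡ (coeff-derivative q k)) (×-comm-* (suc k) a _)) (+-congˡ (shift-derivative (p *ᵖ q) k)) ⟨
    a * coeff (derivative q) k + (coeff (p *ᵖ q) k + shift (coeff (derivative (p *ᵖ q))) k)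
      ≈⟨ +-congˡ (+-congˡ (trans
           (shift-cong (λ m → trans (derivative-* p q m) (coeff-+ (derivative p *ᵖ q) (p *ᵖ derivative q) m)) k)
           (shift-+ (coeff (derivative p *ᵖ q)) (coeff (p *ᵖ derivative q)) k))) ⟩
    a * coeff (derivative q) k +
      (coeff (p *ᵖ q) k + (shift (coeff (derivative p *ᵖ q)) k + shift (coeff (p *ᵖ derivative q)) k))
      ≈⟨ solve 4 (λ x y z w → x :+ (y :+ (z :+ w)) := y :+ z :+ (x :+ w)) refl _ _ _ _ ⟩
    coeff (p *ᵖ q) k + shift (coeff (derivative p *ᵖ q)) k +
      (a * coeff (derivative q) k + shift (coeff (p *ᵖ derivative q)) k)
      ≈⟨ +-cong (trans (*ᵖ-distribʳ-+ᵖ q p (0# ∷ derivative p) k)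
                  (trans (coeff-+ (p *ᵖ q) _ k) (+-congˡ (coeff-0∷-* (derivative p) q k))))
           (coeff-∷-* a p (derivative q) k) ⟨
    coeff (derivative (a ∷ p) *ᵖ q) k + coeff ((a ∷ p) *ᵖ derivative q) k
      ≈⟨ coeff-+ (derivative (a ∷ p) *ᵖ q) ((a ∷ p) *ᵖ derivative q) k ⟨
    coeff (derivative (a ∷ p) *ᵖ q +ᵖ (a ∷ p) *ᵖ derivative q) k ∎

-- Characteristic polynomials, power traces and Newton's identities.

module CharacteristicPolynomialProperties {c ℓ} (R : CommutativeRing c ℓ) where
  open CommutativeRing R hiding (zero)
  open PolynomialRing R
  open CharacteristicPolynomial rawRing using () renaming (charpoly to χ)
  open DeterminantProperties R using (δ; δ-refl; sum-zero; sum-δ; δ-sym; sign; det; det-δ; det-zeroRow)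
  module P = DeterminantProperties polyRing
  open import Algebra.Properties.Semiring.Sum (CommutativeRing.semiring polyRing) using () renaming (sum to sumᵖ)
  open import Algebra.Properties.Semiring.Sum semiring
  open import Algebra.Properties.Ring ring using (-0#≈0#)
  open import Algebra.Properties.CommutativeMonoid.Mult +-commutativeMonoid using (×-congʳ; ×-homo-+) renaming (_×_ to _·_)
  open import Algebra.Properties.Group +-group using (identityʳ-unique; ∙-cancelˡ; ∙-cancelʳ)
  open import Algebra.Solver.Ring.NaturalCoefficients.Default commutativeSemiring
  open import Relation.Binary.Reasoning.Setoid setoid

  infix 4 _HasTop_at_

  -- A degree bound together with the coefficient at the bound. That coefficient may be 0, so the
  -- notion passes to sums and products unconditionally.
  record _HasTop_at_ (p : Poly) (a : Carrier) (d : ℕ) : Set ℓ where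
    constructor top
    field
      vanishing : ∀ k → d ℕ.< k → coeff p k ≈ 0#
      leading   : coeff p d ≈ a

  open _HasTop_at_

  top-cong : ∀ {p a b d} → a ≈ b → p HasTop a at d → p HasTop b at d
  top-cong a≈b (top p> pd) = top p> (trans pd a≈b)

  top-+ : ∀ {p q a b d} → p HasTop a at d → q HasTop b at d → p +ᵖ q HasTop a + b at d
  top-+ {p} {q} {d = d} (top p> pd) (top q> qd) = top
    (λ k d<k → trans (coeff-+ p q k) (trans (+-cong (p> k d<k) (q> k d<k)) (+-identityˡ 0#)))
    (trans (coeff-+ p q d) (+-cong pd qd))

  top-neg : ∀ {p a d} → p HasTop a at d → map -_ p HasTop - a at d
  top-neg {p} {d = d} (top p> pd) = top
    (λ k d<k → trans (coeff-neg p k) (trans (-‿cong (p> k d<k)) -0#≈0#))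
    (trans (coeff-neg p d) (-‿cong pd))

  top-0 : ∀ {d} → [] HasTop 0# at d
  top-0 = top (λ _ _ → refl) refl

  top-const : ∀ a → (a ∷ []) HasTop a at 0
  top-const a = top (λ { (suc k) _ → refl }) refl

  top-* : ∀ {p q a b} d e → p HasTop a at d → q HasTop b at e → p *ᵖ q HasTop a * b at d ℕ.+ e
  top-* {[]} d e (top _ 0≈a) _ = top (λ _ _ → refl) (sym (trans (*-congʳ (sym 0≈a)) (zeroˡ _)))
  top-* {x ∷ p} {q} zero e (top p> x≈a) (top q> qe) = top
    (λ k e<k → trans (constant k) (trans (*-congˡ (q> k e<k)) (zeroʳ x)))
    (trans (constant e) (*-cong x≈a qe))
    where
    constant : ∀ k → coeff ((x ∷ p) *ᵖ q) k ≈ x * coeff q k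
    constant k = trans (coeff-∷-* x p q k)
      (trans (+-congˡ (shift-zero (*ᵖ-cong {p} {[]} {q} {q} (λ m → p> (suc m) (s≤s z≤n)) (λ _ → refl)) k)) (+-identityʳ _))
  top-* {x ∷ p} {q} {a} {b} (suc d) e (top p> pd) Q@(top q> qe) = top
    (λ { (suc k) (s≤s d+e<k) → trans (below k (ℕ.<⇒≤ d+e<k)) (vanishing IH k d+e<k) })
    (trans (below (d ℕ.+ e) ℕ.≤-refl) (leading IH))
    where
    IH : p *ᵖ q HasTop a * b at d ℕ.+ e
    IH = top-* {p} d e (top (λ k d<k → p> (suc k) (s≤s d<k)) pd) Q

    -- The summand x q has degree at most e, and k + 1 exceeds e.
    below : ∀ k → d ℕ.+ e ℕ.≤ k → coeff ((x ∷ p) *ᵖ q) (suc k) ≈ coeff (p *ᵖ q) k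
    below k d+e≤k = trans (coeff-∷-* x p q (suc k))
      (trans (+-congʳ (trans (*-congˡ (q> (suc k) (s≤s (ℕ.≤-trans (ℕ.m≤n+m e d) d+e≤k)))) (zeroʳ x))) (+-identityˡ _))

  top-sign : ∀ {n} (j : Fin n) → P.sign j HasTop sign j at 0
  top-sign zero    = top-const 1#
  top-sign (suc j) = top-* 0 0 (top-neg (top-const 1#)) (top-sign j)

  top-sum : ∀ {d n} {f : Vector Poly n} {g : Vector Carrier n} →
    (∀ j → f j HasTop g j at d) → sumᵖ f HasTop sum g at d
  top-sum {n = zero}  tops = top-0
  top-sum {n = suc n} tops = top-+ (tops zero) (top-sum (tops ∘ suc))

  -- Each term of the expansion multiplies n entries of degree at most 1, so only their
  -- X-coefficients reach X^n.
  top-det : ∀ {n} {M : Matrix Poly n} {N : Matrix Carrier n} →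
    (∀ i j → M i j HasTop N i j at 1) → P.det M HasTop det N at n
  top-det {zero}  tops = top-const 1#
  top-det {suc n} tops = top-sum λ j →
    top-* 1 n (top-* 0 1 (top-sign j) (tops zero j)) (top-det λ i k → tops (suc i) (punchIn j k))

  coeff-sum : ∀ {n} (f : Vector Poly n) k → coeff (sumᵖ f) k ≈ sum (λ j → coeff (f j) k)
  coeff-sum {zero}  f k = refl
  coeff-sum {suc n} f k = trans (coeff-+ (f zero) _ k) (+-congˡ (coeff-sum (f ∘ suc) k))

  coeff-δ-* : ∀ {n} (i j : Fin n) q k → coeff (P.δ i j *ᵖ q) k ≈ δ i j * coeff q k
  coeff-δ-* i j q k with does (i ≟ j)
  ... | true  = trans (*ᵖ-identityˡ q k) (sym (*-identityˡ _))
  ... | false = sym (zeroˡ _)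

  infixl 7 _⊗_

  _⊗_ : ∀ {n} → Matrix Carrier n → Matrix Carrier n → Matrix Carrier n
  (A ⊗ B) i j = sum λ k → A i k * B k j

  power : ∀ {n} → Matrix Carrier n → ℕ → Matrix Carrier n
  power A zero    = δ
  power A (suc s) = A ⊗ power A s

  trace : ∀ {n} → Matrix Carrier n → Carrier
  trace A = sum λ i → A i i

  module Newton {n} (A : Matrix Carrier n) where

    -- X - A, written so that `χ A` unfolds to its determinant.
    charMatrix : Matrix Poly n
    charMatrix i j = (if does (i ≟ j) then X else []) +ᵖ map -_ (A i j ∷ [])

    p : ℕ → Carrier
    p = coeff (χ A)

    top-charMatrix : ∀ i j → charMatrix i j HasTop δ i j at 1
    top-charMatrix i j with does (i ≟ j)
    ... | true  = top (λ { (suc zero) (s≤s ()) ; (suc (suc _)) _ → refl }) refl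
    ... | false = top (λ { (suc zero) (s≤s ()) ; (suc (suc _)) _ → refl }) refl

    top-charpoly : χ A HasTop 1# at n
    top-charpoly = top-cong (det-δ {n}) (top-det top-charMatrix)

    -- Row j has been replaced by constants, so the matrix of X-coefficients has a zero row:
    -- cofactors of X - A have degree below n.
    top-adjugate : ∀ i j → P.adjugate charMatrix i j HasTop 0# at n
    top-adjugate i j = top-cong (det-zeroRow δ j) (top-det (top-≔ top-charMatrix j))
      where
      top-δ : ∀ k → P.δ i k HasTop 0# at 1
      top-δ k with does (i ≟ k)
      ... | true  = top (λ { (suc zero) (s≤s ()) ; (suc (suc _)) _ → refl }) refl
      ... | false = top-0

      top-≔ : ∀ {m} {M : Vector (Vector Poly n) m} {N : Vector (Vector Carrier n) m} →
        (∀ i j → M i j HasTop N i j at 1) → ∀ j i′ k →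
        updateAt M j (const (P.δ i)) i′ k HasTop updateAt N j (const (const 0#)) i′ k at 1
      top-≔ tops zero    zero     k = top-δ k
      top-≔ tops zero    (suc i′) k = tops (suc i′) k
      top-≔ tops (suc j) zero     k = tops zero k
      top-≔ tops (suc j) (suc i′) k = top-≔ (tops ∘ suc) j i′ k

    derivative-charMatrix : ∀ i j → derivative (charMatrix i j) ≈ᵖ P.δ i j
    derivative-charMatrix i j with does (i ≟ j)
    ... | true  = λ { zero → +-identityʳ 1# ; (suc zero) → refl ; (suc (suc k)) → refl }
    ... | false = λ { zero → refl ; (suc k) → refl }

    -- The entrywise form of (X - A) q = X q - A q, with the subtracted term moved across.
    coeff-charMatrix-* : ∀ i j q k →
      coeff (charMatrix i j *ᵖ q) k + A i j * coeff q k ≈ δ i j * shift (coeff q) k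
    coeff-charMatrix-* i j q k with does (i ≟ j)
    ... | true = begin
      coeff ((0# + - a ∷ 1# ∷ []) *ᵖ q) k + a * coeff q k
        ≈⟨ +-congʳ (coeff-∷-* (0# + - a) (1# ∷ []) q k) ⟩
      (0# + - a) * coeff q k + shift (coeff ((1# ∷ []) *ᵖ q)) k + a * coeff q k
        ≈⟨ solve 4 (λ x a y z → (con 0 :+ x) :* y :+ z :+ a :* y := (x :+ a) :* y :+ z) refl (- a) a _ _ ⟩
      (- a + a) * coeff q k + shift (coeff ((1# ∷ []) *ᵖ q)) k
        ≈⟨ +-cong (trans (*-congʳ (-‿inverseˡ a)) (zeroˡ _)) (shift-cong (*ᵖ-identityˡ q) k) ⟩
      0# + shift (coeff q) k
        ≈⟨ solve 1 (λ x → con 0 :+ x := con 1 :* x) refl _ ⟩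
      1# * shift (coeff q) k ∎
      where a = A i j
    ... | false = begin
      coeff ((- a ∷ []) *ᵖ q) k + a * coeff q k
        ≈⟨ +-congʳ (coeff-∷-* (- a) [] q k) ⟩
      - a * coeff q k + shift (λ _ → 0#) k + a * coeff q k
        ≈⟨ +-congʳ (trans (+-congˡ (shift-zero (λ _ → refl) k)) (+-identityʳ _)) ⟩
      - a * coeff q k + a * coeff q k
        ≈⟨ distribʳ _ (- a) a ⟨
      (- a + a) * coeff q k
        ≈⟨ *-congʳ (-‿inverseˡ a) ⟩
      0# * coeff q k
        ≈⟨ trans (zeroˡ _) (sym (zeroˡ _)) ⟩
      0# * shift (coeff q) k ∎
      where a = A i j

    -- W s (1 + m) is A^s B_m, where B_m is the coefficient of X^m in the adjugate of X - A;
    -- W s 0 is 0.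
    W : ℕ → ℕ → Matrix Carrier n
    W zero    m i j = shift (coeff (P.adjugate charMatrix i j)) m
    W (suc s) m     = A ⊗ W s m

    W-0 : ∀ s i j → W s 0 i j ≈ 0#
    W-0 zero    i j = refl
    W-0 (suc s) i j = sum-zero (λ k → A i k * W s 0 k j) λ k → trans (*-congˡ (W-0 s k j)) (zeroʳ _)

    W-1+n : ∀ s i j → W s (suc n) i j ≈ 0#
    W-1+n zero    i j = leading (top-adjugate i j)
    W-1+n (suc s) i j = sum-zero (λ k → A i k * W s (suc n) k j) λ k → trans (*-congˡ (W-1+n s k j)) (zeroʳ _)

    -- For s = 0 this is the coefficient of X^m in X B = p I + A B, that is B_(m-1) = p_m I + A B_m.
    -- Larger s follow on multiplying by A from the left.
    W-step : ∀ s m i j → W s m i j ≈ p m * power A s i j + W (suc s) (suc m) i j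
    W-step zero m i j = begin
      f i
        ≈⟨ sum-δ f i ⟨
      sum (λ k → f k * δ k i)
        ≈⟨ sum-cong-≋ (λ k → trans (*-comm (f k) (δ k i)) (*-congʳ {x = f k} (δ-sym k i))) ⟩
      sum (λ k → δ i k * f k)
        ≈⟨ sum-cong-≋ (λ k → coeff-charMatrix-* i k (P.adjugate charMatrix k j) m) ⟨
      sum (λ k → coeff (charMatrix i k *ᵖ P.adjugate charMatrix k j) m + A i k * W zero (suc m) k j)
        ≈⟨ ∑-distrib-+ (λ k → coeff (charMatrix i k *ᵖ P.adjugate charMatrix k j) m) _ ⟩
      sum (λ k → coeff (charMatrix i k *ᵖ P.adjugate charMatrix k j) m) + W 1 (suc m) i j
        ≈⟨ +-congʳ (trans (sym (coeff-sum (λ k → charMatrix i k *ᵖ P.adjugate charMatrix k j) m))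
             (trans (P.*-adjugate charMatrix i j m) (coeff-δ-* i j (χ A) m))) ⟩
      δ i j * p m + W 1 (suc m) i j
        ≈⟨ +-congʳ (*-comm _ _) ⟩
      p m * δ i j + W 1 (suc m) i j ∎
      where
      f : Vector Carrier n
      f k = W zero m k j
    W-step (suc s) m i j = begin
      sum (λ k → A i k * W s m k j)
        ≈⟨ sum-cong-≋ (λ k → trans (*-congˡ {x = A i k} (W-step s m k j))
             (solve 4 (λ a x y z → a :* (x :* y :+ z) := x :* (a :* y) :+ a :* z) refl (A i k) (p m) _ _)) ⟩
      sum (λ k → p m * (A i k * power A s k j) + A i k * W (suc s) (suc m) k j)
        ≈⟨ ∑-distrib-+ (λ k → p m * (A i k * power A s k j)) _ ⟩
      sum (λ k → p m * (A i k * power A s k j)) + W (suc (suc s)) (suc m) i j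
        ≈⟨ +-congʳ (*-distribˡ-sum (p m) (λ k → A i k * power A s k j)) ⟨
      p m * power A (suc s) i j + W (suc (suc s)) (suc m) i j ∎

    t : ℕ → Carrier
    t s = trace (power A s)

    τ : ℕ → ℕ → Carrier
    τ s m = trace (W s m)

    -- This and `τ-1+n` are the boundary values for `τ-step`: the adjugate has no coefficient of
    -- index -1 or n.
    τ-0 : ∀ s → τ s 0 ≈ 0#
    τ-0 s = sum-zero (λ i → W s 0 i i) λ i → W-0 s i i

    τ-1+n : ∀ s → τ s (suc n) ≈ 0#
    τ-1+n s = sum-zero (λ i → W s (suc n) i i) λ i → W-1+n s i i

    τ-step : ∀ s m → τ s m ≈ p m * t s + τ (suc s) (suc m)
    τ-step s m = begin
      sum (λ i → W s m i i)
        ≈⟨ sum-cong-≋ (λ i → W-step s m i i) ⟩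
      sum (λ i → p m * power A s i i + W (suc s) (suc m) i i)
        ≈⟨ ∑-distrib-+ (λ i → p m * power A s i i) _ ⟩
      sum (λ i → p m * power A s i i) + τ (suc s) (suc m)
        ≈⟨ +-congʳ (*-distribˡ-sum (p m) (λ i → power A s i i)) ⟨
      p m * t s + τ (suc s) (suc m) ∎

    -- Jacobi's formula multiplied by X, which matches the shift built into `W`.
    τ-derivative : ∀ m → τ 0 m ≈ m · p m
    τ-derivative m = begin
      sum (λ i → shift (coeff (P.adjugate charMatrix i i)) m)
        ≈⟨ sum-shift m ⟩
      shift (coeff (sumᵖ (λ i → P.adjugate charMatrix i i))) m
        ≈⟨ shift-cong (λ k → sym (jacobi k)) m ⟩
      shift (coeff (derivative (χ A))) m
        ≈⟨ shift-derivative (χ A) m ⟩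
      m · p m ∎
      where
      sum-shift : ∀ m → sum (λ i → shift (coeff (P.adjugate charMatrix i i)) m) ≈
        shift (coeff (sumᵖ (λ i → P.adjugate charMatrix i i))) m
      sum-shift zero    = sum-replicate-zero n
      sum-shift (suc m) = sym (coeff-sum (λ i → P.adjugate charMatrix i i) m)

      open P.Derivation derivative (λ {p} {q} → derivative-cong {p} {q}) derivative-+ derivative-*

      -- Differentiating row i of X - A gives row i of the identity matrix, and a determinant with
      -- that row put in place is the i-th diagonal cofactor.
      jacobi : derivative (χ A) ≈ᵖ sumᵖ (λ i → P.adjugate charMatrix i i)
      jacobi k = begin
        coeff (derivative (χ A)) k
          ≈⟨ D-det charMatrix k ⟩
        coeff (sumᵖ (λ i → P.det (charMatrix [ i ≔ derivative ∘ charMatrix i ]))) k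
          ≈⟨ coeff-sum (λ i → P.det (charMatrix [ i ≔ derivative ∘ charMatrix i ])) k ⟩
        sum (λ i → coeff (P.det (charMatrix [ i ≔ derivative ∘ charMatrix i ])) k)
          ≈⟨ sum-cong-≋ (λ i → P.det-≔-cong charMatrix i (derivative-charMatrix i) k) ⟩
        sum (λ i → coeff (P.adjugate charMatrix i i) k)
          ≈⟨ coeff-sum (λ i → P.adjugate charMatrix i i) k ⟨
        coeff (sumᵖ (λ i → P.adjugate charMatrix i i)) k ∎

    t-0 : ∀ x → x * t 0 ≈ n · x
    t-0 x = begin
      x * sum (λ (i : Fin n) → δ i i)    ≈⟨ *-congˡ (sum-cong-≋ (δ-refl {n})) ⟩
      x * sum (λ (i : Fin n) → 1#)       ≈⟨ *-distribˡ-sum x (λ (i : Fin n) → 1#) ⟩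
      sum (λ (i : Fin n) → x * 1#)       ≈⟨ sum-replicate n ⟩
      n · (x * 1#)                       ≈⟨ ×-congʳ n (*-identityʳ x) ⟩
      n · x                              ∎

    -- `τ 0 m` has two values, m p_m by Jacobi and n p_m + `τ 1 (suc m)` by the recursion; d stands
    -- for n - m. Unrolling `τ` gives the usual identity d p_m + p_(m+1) t_1 + ... + p_n t_d = 0.
    newton : ∀ m d → m ℕ.+ d ≡ n → d · p m + τ 1 (suc m) ≈ 0#
    newton m d m+d≡n = identityʳ-unique (m · p m) _ (begin
      m · p m + (d · p m + τ 1 (suc m))     ≈⟨ +-assoc _ _ _ ⟨
      m · p m + d · p m + τ 1 (suc m)       ≈⟨ +-congʳ (×-homo-+ (p m) m d) ⟨
      (m ℕ.+ d) · p m + τ 1 (suc m)         ≈⟨ +-congʳ (reflexive (≡.cong (_· p m) m+d≡n)) ⟩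
      n · p m + τ 1 (suc m)                 ≈⟨ +-congʳ (t-0 (p m)) ⟨
      p m * t 0 + τ 1 (suc m)               ≈⟨ τ-step 0 m ⟨
      τ 0 m                                 ≈⟨ τ-derivative m ⟩
      m · p m                               ∎)

  module _ {n} (A B : Matrix Carrier n) where
    private
      module A = Newton A
      module B = Newton B

    -- Strong induction on s. The diagonal through (s, n) ends in t_s, because p is monic, and every
    -- earlier step involves only t_i with i < s, already known to agree.
    cospectral⇒trace-power : χ A ≈ᵖ χ B → ∀ s → A.t s ≈ B.t s
    cospectral⇒trace-power p≈ = <-rec _ step
      where
      descend : ∀ s → (∀ {r} → r ℕ.< s → A.t r ≈ B.t r) →
        ∀ d i m → i ℕ.+ d ≡ s → m ℕ.+ d ≡ n → A.τ i m ≈ B.τ i m → A.t s ≈ B.t s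
      descend s below zero i m i≡s m≡n τᴬ≈τᴮ
        rewrite ≡.trans (≡.sym (ℕ.+-identityʳ m)) m≡n | ≡.trans (≡.sym (ℕ.+-identityʳ i)) i≡s =
        trans (sym (τ-top A)) (trans τᴬ≈τᴮ (τ-top B))
        where
        τ-top : ∀ C → Newton.τ C s n ≈ Newton.t C s
        τ-top C = begin
          C.τ s n                              ≈⟨ C.τ-step s n ⟩
          C.p n * C.t s + C.τ (suc s) (suc n)  ≈⟨ +-cong (*-congʳ (leading C.top-charpoly)) (C.τ-1+n (suc s)) ⟩
          1# * C.t s + 0#                      ≈⟨ solve 1 (λ x → con 1 :* x :+ con 0 := x) refl _ ⟩
          C.t s                                ∎
          where module C = Newton C
      descend s below (suc d) i m i+d≡s m+d≡n τᴬ≈τᴮ =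
        descend s below d (suc i) (suc m)
          (≡.trans (≡.sym (ℕ.+-suc i d)) i+d≡s) (≡.trans (≡.sym (ℕ.+-suc m d)) m+d≡n)
          (∙-cancelˡ (A.p m * A.t i) _ _ (begin
            A.p m * A.t i + A.τ (suc i) (suc m)  ≈⟨ A.τ-step i m ⟨
            A.τ i m                              ≈⟨ τᴬ≈τᴮ ⟩
            B.τ i m                              ≈⟨ B.τ-step i m ⟩
            B.p m * B.t i + B.τ (suc i) (suc m)  ≈⟨ +-congʳ (*-cong (p≈ m) (below i<s)) ⟨
            A.p m * A.t i + B.τ (suc i) (suc m)  ∎))
        where
        i<s : i ℕ.< s
        i<s = ≡.subst (i ℕ.<_) i+d≡s (ℕ.m<m+n i (s≤s z≤n))

      step : ∀ s → (∀ {r} → r ℕ.< s → A.t r ≈ B.t r) → A.t s ≈ B.t s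
      step s below with ℕ.≤-total s n
      -- The diagonal starts on the edge s = 0, at (0, n - s), where Jacobi's formula gives the
      -- value.
      ... | inj₁ s≤n = descend s below s 0 (n ℕ.∸ s) ≡.refl (ℕ.m∸n+n≡m s≤n)
        (trans (A.τ-derivative m) (trans (×-congʳ m (p≈ m)) (sym (B.τ-derivative m))))
        where m = n ℕ.∸ s
      -- The diagonal starts on the edge m = 0. Unrolled, this is the trace of A^(s-n) p(A) = 0, a
      -- case of Cayley-Hamilton.
      ... | inj₂ n≤s = descend s below n (s ℕ.∸ n) 0 (ℕ.m∸n+n≡m n≤s) ≡.refl
        (trans (A.τ-0 (s ℕ.∸ n)) (sym (B.τ-0 (s ℕ.∸ n))))

    -- Downward induction on m from the leading coefficient. The equality of `τ s m` is carried for
    -- all s at once, since the recursion raises s with m; `newton` then determines (n - m) p_m, and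
    -- `cancel` divides.
    trace-power⇒cospectral : (∀ d {x y} → suc d · x ≈ suc d · y → x ≈ y) →
      (∀ s → A.t s ≈ B.t s) → χ A ≈ᵖ χ B
    trace-power⇒cospectral cancel t≈ k with ℕ.≤-<-connex k n
    ... | inj₂ n<k = trans (vanishing A.top-charpoly k n<k) (sym (vanishing B.top-charpoly k n<k))
    ... | inj₁ k≤n = proj₁ (descend (n ℕ.∸ k) k (ℕ.m+[n∸m]≡n k≤n))
      where
      p⇒τ : ∀ m → A.p m ≈ B.p m → (∀ s → A.τ s (suc m) ≈ B.τ s (suc m)) → ∀ s → A.τ s m ≈ B.τ s m
      p⇒τ m p≈ τ≈ s = trans (A.τ-step s m)
        (trans (+-cong (*-cong p≈ (t≈ s)) (τ≈ (suc s))) (sym (B.τ-step s m)))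

      descend : ∀ d m → m ℕ.+ d ≡ n → A.p m ≈ B.p m × (∀ s → A.τ s m ≈ B.τ s m)
      descend zero m m≡n rewrite ≡.trans (≡.sym (ℕ.+-identityʳ m)) m≡n =
        p≈ , p⇒τ n p≈ λ s → trans (A.τ-1+n s) (sym (B.τ-1+n s))
        where
        p≈ : A.p n ≈ B.p n
        p≈ = trans (leading A.top-charpoly) (sym (leading B.top-charpoly))
      descend (suc d) m m+d≡n = p≈ , p⇒τ m p≈ τ≈
        where
        τ≈ : ∀ s → A.τ s (suc m) ≈ B.τ s (suc m)
        τ≈ = proj₂ (descend d (suc m) (≡.trans (≡.sym (ℕ.+-suc m d)) m+d≡n))

        p≈ : A.p m ≈ B.p m
        p≈ = cancel d (∙-cancelʳ (A.τ 1 (suc m)) _ _ (begin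
          suc d · A.p m + A.τ 1 (suc m)    ≈⟨ A.newton m (suc d) m+d≡n ⟩
          0#                               ≈⟨ B.newton m (suc d) m+d≡n ⟨
          suc d · B.p m + B.τ 1 (suc m)    ≈⟨ +-congˡ (τ≈ 1) ⟨
          suc d · B.p m + A.τ 1 (suc m)    ∎))

-- Cauchy reals: arithmetic and order through null sequences.

module Reals where
  open +-*-Solver

  half : ∀ {ε} → 0ℚ ℚ.< ε → 0ℚ ℚ.< ½ ℚ.* ε
  half 0<ε = ℚ.*-monoʳ-<-pos ½ 0<ε

  half+half : ∀ ε → ½ ℚ.* ε ℚ.+ ½ ℚ.* ε ≡ ε
  half+half = solve 1 (λ ε → con ½ :* ε :+ con ½ :* ε := ε) ≡.refl

  -- `x ≈ℝ y` says that the termwise difference is null, so congruence proofs become rational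
  -- identities between null sequences.
  Null : (ℕ → ℚ) → Set
  Null f = ∀ ε → 0ℚ ℚ.< ε → ∃ λ N → ∀ n → N ℕ.≤ n → ℚ.∣ f n ∣ ℚ.< ε

  null-cong : ∀ {f g} → (∀ n → f n ≡ g n) → Null f → Null g
  null-cong f≗g f→0 ε 0<ε with f→0 ε 0<ε
  ... | N , small = N , λ n N≤n → ≡.subst (λ q → ℚ.∣ q ∣ ℚ.< ε) (f≗g n) (small n N≤n)

  null-zero : ∀ {f} → (∀ n → f n ≡ 0ℚ) → Null f
  null-zero f≗0 ε 0<ε = 0 , λ n _ → ≡.subst (λ q → ℚ.∣ q ∣ ℚ.< ε) (≡.sym (f≗0 n)) 0<ε

  null-neg : ∀ {f} → Null f → Null (λ n → ℚ.- f n)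
  null-neg {f} f→0 ε 0<ε with f→0 ε 0<ε
  ... | N , small = N , λ n N≤n → ≡.subst (ℚ._< ε) (≡.sym (ℚ.∣-p∣≡∣p∣ (f n))) (small n N≤n)

  null-+ : ∀ {f g} → Null f → Null g → Null (λ n → f n ℚ.+ g n)
  null-+ {f} {g} f→0 g→0 ε 0<ε with f→0 (½ ℚ.* ε) (half 0<ε) | g→0 (½ ℚ.* ε) (half 0<ε)
  ... | N₁ , small₁ | N₂ , small₂ = N₁ ℕ.⊔ N₂ , λ n N≤n → begin-strict
    ℚ.∣ f n ℚ.+ g n ∣            ≤⟨ ℚ.∣p+q∣≤∣p∣+∣q∣ (f n) (g n) ⟩
    ℚ.∣ f n ∣ ℚ.+ ℚ.∣ g n ∣      <⟨ ℚ.+-mono-< (small₁ n (ℕ.m⊔n≤o⇒m≤o N₁ N₂ N≤n)) (small₂ n (ℕ.m⊔n≤o⇒n≤o N₁ N₂ N≤n)) ⟩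
    ½ ℚ.* ε ℚ.+ ½ ℚ.* ε          ≡⟨ half+half ε ⟩
    ε                            ∎
    where open ℚ.≤-Reasoning

  bounded : ∀ y → ∃ λ B → (0ℚ ℚ.< B) × (∃ λ N → ∀ n → N ℕ.≤ n → ℚ.∣ seq y n ∣ ℚ.≤ B)
  bounded y with cauchy y 1ℚ (ℚ.positive⁻¹ 1ℚ)
  ... | N , near = 1ℚ ℚ.+ ℚ.∣ seq y N ∣ , ℚ.+-mono-<-≤ (ℚ.positive⁻¹ 1ℚ) (ℚ.0≤∣p∣ (seq y N)) , N , λ n N≤n → begin
    ℚ.∣ seq y n ∣                                    ≡⟨ ≡.cong ℚ.∣_∣ (solve 2 (λ a b → a := (a :- b) :+ b) ≡.refl (seq y n) (seq y N)) ⟩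
    ℚ.∣ (seq y n ℚ.- seq y N) ℚ.+ seq y N ∣          ≤⟨ ℚ.∣p+q∣≤∣p∣+∣q∣ (seq y n ℚ.- seq y N) (seq y N) ⟩
    ℚ.∣ seq y n ℚ.- seq y N ∣ ℚ.+ ℚ.∣ seq y N ∣      ≤⟨ ℚ.+-monoˡ-≤ ℚ.∣ seq y N ∣ (ℚ.<⇒≤ (near n N N≤n ℕ.≤-refl)) ⟩
    1ℚ ℚ.+ ℚ.∣ seq y N ∣                             ∎
    where open ℚ.≤-Reasoning

  divide : ∀ B ε → 0ℚ ℚ.< B → 0ℚ ℚ.< ε → ∃ λ δ → (0ℚ ℚ.< δ) × (δ ℚ.* B ≡ ε)
  divide B ε 0<B 0<ε = ε ℚ.* ℚ.1/ B , 0<δ , ≡.trans (ℚ.*-assoc ε (ℚ.1/ B) B)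
    (≡.trans (≡.cong (ε ℚ.*_) (ℚ.*-inverseˡ B)) (ℚ.*-identityʳ ε))
    where
    instance
      B-positive : ℚ.Positive B
      B-positive = ℚ.positive 0<B
      B-nonZero : ℚ.NonZero B
      B-nonZero = ℚ.pos⇒nonZero B
    0<δ : 0ℚ ℚ.< ε ℚ.* ℚ.1/ B
    0<δ = ≡.subst (ℚ._< ε ℚ.* ℚ.1/ B) (ℚ.*-zeroʳ ε)
      (ℚ.*-monoʳ-<-pos ε {{ℚ.positive 0<ε}} (ℚ.positive⁻¹ (ℚ.1/ B) {{ℚ.1/pos⇒pos B}}))

  ∣∣-*-< : ∀ p q {B δ} → 0ℚ ℚ.< B → ℚ.∣ p ∣ ℚ.< δ → ℚ.∣ q ∣ ℚ.≤ B → ℚ.∣ p ℚ.* q ∣ ℚ.< δ ℚ.* B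
  ∣∣-*-< p q {B} {δ} 0<B p<δ q≤B = begin-strict
    ℚ.∣ p ℚ.* q ∣           ≡⟨ ℚ.∣p*q∣≡∣p∣*∣q∣ p q ⟩
    ℚ.∣ p ∣ ℚ.* ℚ.∣ q ∣     ≤⟨ ℚ.*-monoˡ-≤-nonNeg ℚ.∣ p ∣ {{ℚ.nonNegative (ℚ.0≤∣p∣ p)}} q≤B ⟩
    ℚ.∣ p ∣ ℚ.* B           <⟨ ℚ.*-monoˡ-<-pos B {{ℚ.positive 0<B}} p<δ ⟩
    δ ℚ.* B                 ∎
    where open ℚ.≤-Reasoning

  -- A Cauchy sequence is eventually bounded, by B say, so it suffices to bring f below ε / B.
  null-* : ∀ {f} → Null f → ∀ y → Null (λ n → f n ℚ.* seq y n)
  null-* {f} f→0 y ε 0<ε =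
    let B , 0<B , N₁ , y≤B = bounded y
        δ , 0<δ , δB≡ε = divide B ε 0<B 0<ε
        N₂ , small = f→0 δ 0<δ
    in N₁ ℕ.⊔ N₂ , λ n N≤n → ≡.subst (ℚ.∣ f n ℚ.* seq y n ∣ ℚ.<_) δB≡ε
      (∣∣-*-< (f n) (seq y n) 0<B (small n (ℕ.m⊔n≤o⇒n≤o N₁ N₂ N≤n)) (y≤B n (ℕ.m⊔n≤o⇒m≤o N₁ N₂ N≤n)))

  -- The operations act termwise, so this reduces each ring law to an identity of rationals.
  pointwise : ∀ {x y} → (∀ n → seq x n ≡ seq y n) → x ≈ℝ y
  pointwise {x} {y} x≗y = mk≈ (null-zero λ n → ≡.trans (≡.cong (ℚ._- seq y n) (x≗y n)) (ℚ.+-inverseʳ (seq y n)))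

  ≈ℝ-refl : ∀ {x} → x ≈ℝ x
  ≈ℝ-refl = pointwise λ _ → ≡.refl

  ≈ℝ-sym : ∀ {x y} → x ≈ℝ y → y ≈ℝ x
  ≈ℝ-sym {x} {y} (mk≈ x-y) = mk≈ (null-cong (λ n → solve 2 (λ a b → :- (a :- b) := b :- a) ≡.refl (seq x n) (seq y n)) (null-neg x-y))

  ≈ℝ-trans : ∀ {x y z} → x ≈ℝ y → y ≈ℝ z → x ≈ℝ z
  ≈ℝ-trans {x} {y} {z} (mk≈ x-y) (mk≈ y-z) = mk≈ (null-cong
    (λ n → solve 3 (λ a b c → (a :- b) :+ (b :- c) := a :- c) ≡.refl (seq x n) (seq y n) (seq z n))
    (null-+ x-y y-z))

  +ℝ-cong : ∀ {x x′ y y′} → x ≈ℝ x′ → y ≈ℝ y′ → x +ℝ y ≈ℝ x′ +ℝ y′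
  +ℝ-cong {x} {x′} {y} {y′} (mk≈ x-x′) (mk≈ y-y′) = mk≈ (null-cong
    (λ n → solve 4 (λ a a′ b b′ → (a :- a′) :+ (b :- b′) := (a :+ b) :- (a′ :+ b′)) ≡.refl
      (seq x n) (seq x′ n) (seq y n) (seq y′ n))
    (null-+ x-x′ y-y′))

  *ℝ-cong : ∀ {x x′ y y′} → x ≈ℝ x′ → y ≈ℝ y′ → x *ℝ y ≈ℝ x′ *ℝ y′
  *ℝ-cong {x} {x′} {y} {y′} (mk≈ x-x′) (mk≈ y-y′) = mk≈ (null-cong
    (λ n → solve 4 (λ a a′ b b′ → (a :- a′) :* b :+ (b :- b′) :* a′ := a :* b :- a′ :* b′) ≡.refl
      (seq x n) (seq x′ n) (seq y n) (seq y′ n))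
    (null-+ (null-* x-x′ y) (null-* y-y′ x′)))

  -ℝ-cong : ∀ {x y} → x ≈ℝ y → -ℝ x ≈ℝ -ℝ y
  -ℝ-cong {x} {y} (mk≈ x-y) = mk≈ (null-cong
    (λ n → solve 2 (λ a b → :- (a :- b) := :- a :- :- b) ≡.refl (seq x n) (seq y n)) (null-neg x-y))

  ≈0⇒null : ∀ {x} → x ≈ℝ fromℚ 0ℚ → Null (seq x)
  ≈0⇒null (mk≈ x-0) = null-cong (λ n → ℚ.+-identityʳ _) x-0

  null⇒≈0 : ∀ {x} → Null (seq x) → x ≈ℝ fromℚ 0ℚ
  null⇒≈0 x→0 = mk≈ (null-cong (λ n → ≡.sym (ℚ.+-identityʳ _)) x→0)

  infix 4 0≤_

  0≤_ : ℝ → Set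
  0≤ x = fromℚ 0ℚ ≤ℝ x

  0≤-zero : 0≤ fromℚ 0ℚ
  0≤-zero = mk≤ λ ε 0<ε → 0 , λ _ _ → ≡.subst (0ℚ ℚ.<_) (≡.sym (ℚ.+-identityˡ ε)) 0<ε

  0≤-+ : ∀ {x y} → 0≤ x → 0≤ y → 0≤ x +ℝ y
  0≤-+ {x} {y} (mk≤ 0≤x) (mk≤ 0≤y) = mk≤ below
    where
    below : ∀ ε → 0ℚ ℚ.< ε → ∃ λ N → ∀ n → N ℕ.≤ n → 0ℚ ℚ.< (seq x n ℚ.+ seq y n) ℚ.+ ε
    below ε 0<ε with 0≤x (½ ℚ.* ε) (half 0<ε) | 0≤y (½ ℚ.* ε) (half 0<ε)
    ... | N₁ , x> | N₂ , y> = N₁ ℕ.⊔ N₂ , λ n N≤n → begin-strict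
      0ℚ                                                          <⟨ ℚ.+-mono-< (x> n (ℕ.m⊔n≤o⇒m≤o N₁ N₂ N≤n)) (y> n (ℕ.m⊔n≤o⇒n≤o N₁ N₂ N≤n)) ⟩
      (seq x n ℚ.+ ½ ℚ.* ε) ℚ.+ (seq y n ℚ.+ ½ ℚ.* ε)             ≡⟨ solve 3 (λ a b e → (a :+ con ½ :* e) :+ (b :+ con ½ :* e) := (a :+ b) :+ e)
                                                                       ≡.refl (seq x n) (seq y n) ε ⟩
      (seq x n ℚ.+ seq y n) ℚ.+ ε                                 ∎
      where open ℚ.≤-Reasoning

  p≤∣p∣ : ∀ p → p ℚ.≤ ℚ.∣ p ∣
  p≤∣p∣ p with ℚ.≤-total 0ℚ p
  ... | inj₁ 0≤p = ℚ.≤-reflexive (≡.sym (ℚ.0≤p⇒∣p∣≡p 0≤p))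
  ... | inj₂ p≤0 = ℚ.≤-trans p≤0 (ℚ.0≤∣p∣ p)

  ∣∣<-intro : ∀ {p q} → ℚ.- q ℚ.< p → p ℚ.< q → ℚ.∣ p ∣ ℚ.< q
  ∣∣<-intro {p} {q} -q<p p<q with ℚ.∣p∣≡p∨∣p∣≡-p p
  ... | inj₁ ∣p∣≡p  = ≡.subst (ℚ._< q) (≡.sym ∣p∣≡p) p<q
  ... | inj₂ ∣p∣≡-p = ≡.subst₂ ℚ._<_ (≡.sym ∣p∣≡-p) (solve 1 (λ q → :- :- q := q) ≡.refl q) (ℚ.neg-antimono-< -q<p)

  -- Eventually -ε < x from 0 ≤ x, while 0 ≤ y bounds x above by x + y + ε / 2, which is eventually
  -- below ε.
  0≤-+≈0 : ∀ {x y} → 0≤ x → 0≤ y → x +ℝ y ≈ℝ fromℚ 0ℚ → x ≈ℝ fromℚ 0ℚ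
  0≤-+≈0 {x} {y} (mk≤ 0≤x) (mk≤ 0≤y) x+y≈0 = null⇒≈0 small
    where
    small : Null (seq x)
    small ε 0<ε with 0≤x ε 0<ε | 0≤y (½ ℚ.* ε) (half 0<ε) | ≈0⇒null x+y≈0 (½ ℚ.* ε) (half 0<ε)
    ... | N₁ , x> | N₂ , y> | N₃ , x+y< = N₁ ℕ.⊔ (N₂ ℕ.⊔ N₃) , λ n N≤n →
      let N₂⊔N₃≤n = ℕ.m⊔n≤o⇒n≤o N₁ (N₂ ℕ.⊔ N₃) N≤n
          a = seq x n
          b = seq y n
      in ∣∣<-intro
        (begin-strict
          ℚ.- ε                  ≡⟨ ℚ.+-identityˡ _ ⟨
          0ℚ ℚ.- ε               <⟨ ℚ.+-monoˡ-< (ℚ.- ε) (x> n (ℕ.m⊔n≤o⇒m≤o N₁ (N₂ ℕ.⊔ N₃) N≤n)) ⟩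
          a ℚ.+ ε ℚ.- ε          ≡⟨ solve 2 (λ a e → a :+ e :- e := a) ≡.refl a ε ⟩
          a                      ∎)
        (begin-strict
          a                                      ≡⟨ ℚ.+-identityʳ a ⟨
          a ℚ.+ 0ℚ                               <⟨ ℚ.+-monoʳ-< a (y> n (ℕ.m⊔n≤o⇒m≤o N₂ N₃ N₂⊔N₃≤n)) ⟩
          a ℚ.+ (b ℚ.+ ½ ℚ.* ε)                  ≡⟨ ℚ.+-assoc a b _ ⟨
          a ℚ.+ b ℚ.+ ½ ℚ.* ε                    ≤⟨ ℚ.+-monoˡ-≤ (½ ℚ.* ε) (p≤∣p∣ (a ℚ.+ b)) ⟩
          ℚ.∣ a ℚ.+ b ∣ ℚ.+ ½ ℚ.* ε              <⟨ ℚ.+-monoˡ-< (½ ℚ.* ε) (x+y< n (ℕ.m⊔n≤o⇒n≤o N₂ N₃ N₂⊔N₃≤n)) ⟩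
          ½ ℚ.* ε ℚ.+ ½ ℚ.* ε                    ≡⟨ half+half ε ⟩
          ε                                      ∎)
      where open ℚ.≤-Reasoning

-- The ring of complex numbers and its elements of modulus 1.

module Complexes where
  open Reals
  open RawRing ℂ-rawRing using (0#; 1#)
  open +-*-Solver

  pointwiseℂ : ∀ {z w} → (∀ n → seq (re z) n ≡ seq (re w) n) → (∀ n → seq (im z) n ≡ seq (im w) n) → z ≈ℂ w
  pointwiseℂ re≗ im≗ = pointwise re≗ ,≈ pointwise im≗

  +ℂ-assoc : ∀ z w v → (z +ℂ w) +ℂ v ≈ℂ z +ℂ (w +ℂ v)
  +ℂ-assoc z w v = pointwiseℂ (λ n → ℚ.+-assoc (seq (re z) n) _ _) (λ n → ℚ.+-assoc (seq (im z) n) _ _)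

  +ℂ-comm : ∀ z w → z +ℂ w ≈ℂ w +ℂ z
  +ℂ-comm z w = pointwiseℂ (λ n → ℚ.+-comm (seq (re z) n) _) (λ n → ℚ.+-comm (seq (im z) n) _)

  +ℂ-identityˡ : ∀ z → 0# +ℂ z ≈ℂ z
  +ℂ-identityˡ z = pointwiseℂ (λ n → ℚ.+-identityˡ _) (λ n → ℚ.+-identityˡ _)

  +ℂ-identityʳ : ∀ z → z +ℂ 0# ≈ℂ z
  +ℂ-identityʳ z = pointwiseℂ (λ n → ℚ.+-identityʳ _) (λ n → ℚ.+-identityʳ _)

  +ℂ-inverseˡ : ∀ z → -ℂ z +ℂ z ≈ℂ 0#
  +ℂ-inverseˡ z = pointwiseℂ (λ n → ℚ.+-inverseˡ (seq (re z) n)) (λ n → ℚ.+-inverseˡ (seq (im z) n))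

  +ℂ-inverseʳ : ∀ z → z +ℂ -ℂ z ≈ℂ 0#
  +ℂ-inverseʳ z = pointwiseℂ (λ n → ℚ.+-inverseʳ (seq (re z) n)) (λ n → ℚ.+-inverseʳ (seq (im z) n))

  *ℂ-comm : ∀ z w → z *ℂ w ≈ℂ w *ℂ z
  *ℂ-comm z w = pointwiseℂ
    (λ n → solve 4 (λ a b c d → a :* c :+ :- (b :* d) := c :* a :+ :- (d :* b)) ≡.refl
      (seq (re z) n) (seq (im z) n) (seq (re w) n) (seq (im w) n))
    (λ n → solve 4 (λ a b c d → a :* d :+ b :* c := c :* b :+ d :* a) ≡.refl
      (seq (re z) n) (seq (im z) n) (seq (re w) n) (seq (im w) n))

  *ℂ-assoc : ∀ z w v → (z *ℂ w) *ℂ v ≈ℂ z *ℂ (w *ℂ v)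
  *ℂ-assoc z w v = pointwiseℂ
    (λ n → solve 6 (λ a b c d e f →
      (a :* c :+ :- (b :* d)) :* e :+ :- ((a :* d :+ b :* c) :* f) :=
      a :* (c :* e :+ :- (d :* f)) :+ :- (b :* (c :* f :+ d :* e))) ≡.refl
      (seq (re z) n) (seq (im z) n) (seq (re w) n) (seq (im w) n) (seq (re v) n) (seq (im v) n))
    (λ n → solve 6 (λ a b c d e f →
      (a :* c :+ :- (b :* d)) :* f :+ (a :* d :+ b :* c) :* e :=
      a :* (c :* f :+ d :* e) :+ b :* (c :* e :+ :- (d :* f))) ≡.refl
      (seq (re z) n) (seq (im z) n) (seq (re w) n) (seq (im w) n) (seq (re v) n) (seq (im v) n))

  *ℂ-distribˡ : ∀ z w v → z *ℂ (w +ℂ v) ≈ℂ z *ℂ w +ℂ z *ℂ v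
  *ℂ-distribˡ z w v = pointwiseℂ
    (λ n → solve 6 (λ a b c d e f →
      a :* (c :+ e) :+ :- (b :* (d :+ f)) := (a :* c :+ :- (b :* d)) :+ (a :* e :+ :- (b :* f))) ≡.refl
      (seq (re z) n) (seq (im z) n) (seq (re w) n) (seq (im w) n) (seq (re v) n) (seq (im v) n))
    (λ n → solve 6 (λ a b c d e f →
      a :* (d :+ f) :+ b :* (c :+ e) := (a :* d :+ b :* c) :+ (a :* f :+ b :* e)) ≡.refl
      (seq (re z) n) (seq (im z) n) (seq (re w) n) (seq (im w) n) (seq (re v) n) (seq (im v) n))

  *ℂ-distribʳ : ∀ z w v → (w +ℂ v) *ℂ z ≈ℂ w *ℂ z +ℂ v *ℂ z
  *ℂ-distribʳ z w v = pointwiseℂ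
    (λ n → solve 6 (λ a b c d e f →
      (c :+ e) :* a :+ :- ((d :+ f) :* b) := (c :* a :+ :- (d :* b)) :+ (e :* a :+ :- (f :* b))) ≡.refl
      (seq (re z) n) (seq (im z) n) (seq (re w) n) (seq (im w) n) (seq (re v) n) (seq (im v) n))
    (λ n → solve 6 (λ a b c d e f →
      (c :+ e) :* b :+ (d :+ f) :* a := (c :* b :+ d :* a) :+ (e :* b :+ f :* a)) ≡.refl
      (seq (re z) n) (seq (im z) n) (seq (re w) n) (seq (im w) n) (seq (re v) n) (seq (im v) n))

  *ℂ-identityˡ : ∀ z → 1# *ℂ z ≈ℂ z
  *ℂ-identityˡ z = pointwiseℂ
    (λ n → solve 2 (λ a b → con 1ℚ :* a :+ :- (con 0ℚ :* b) := a) ≡.refl (seq (re z) n) (seq (im z) n))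
    (λ n → solve 2 (λ a b → con 1ℚ :* b :+ con 0ℚ :* a := b) ≡.refl (seq (re z) n) (seq (im z) n))

  *ℂ-identityʳ : ∀ z → z *ℂ 1# ≈ℂ z
  *ℂ-identityʳ z = pointwiseℂ
    (λ n → solve 2 (λ a b → a :* con 1ℚ :+ :- (b :* con 0ℚ) := a) ≡.refl (seq (re z) n) (seq (im z) n))
    (λ n → solve 2 (λ a b → a :* con 0ℚ :+ b :* con 1ℚ := b) ≡.refl (seq (re z) n) (seq (im z) n))

  ℂ-ring : CommutativeRing 0ℓ 0ℓ
  ℂ-ring = record
    { RawRing ℂ-rawRing
    ; isCommutativeRing = record
      { isRing = record
        { +-isAbelianGroup = record
          { isGroup = record
            { isMonoid = record
              { isSemigroup = record
                { isMagma = record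
                  { isEquivalence = record
                    { refl  = ≈ℝ-refl ,≈ ≈ℝ-refl
                    ; sym   = λ (r ,≈ i) → ≈ℝ-sym r ,≈ ≈ℝ-sym i
                    ; trans = λ (r ,≈ i) (r′ ,≈ i′) → ≈ℝ-trans r r′ ,≈ ≈ℝ-trans i i′
                    }
                  ; ∙-cong = λ (r ,≈ i) (r′ ,≈ i′) → +ℝ-cong r r′ ,≈ +ℝ-cong i i′
                  }
                ; assoc = +ℂ-assoc
                }
              ; identity = +ℂ-identityˡ , +ℂ-identityʳ
              }
            ; inverse = +ℂ-inverseˡ , +ℂ-inverseʳ
            ; ⁻¹-cong = λ (r ,≈ i) → -ℝ-cong r ,≈ -ℝ-cong i
            }
          ; comm = +ℂ-comm
          }
        ; *-cong = λ (r ,≈ i) (r′ ,≈ i′) →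
            +ℝ-cong (*ℝ-cong r r′) (-ℝ-cong (*ℝ-cong i i′)) ,≈ +ℝ-cong (*ℝ-cong r i′) (*ℝ-cong i r′)
        ; *-assoc = *ℂ-assoc
        ; *-identity = *ℂ-identityˡ , *ℂ-identityʳ
        ; distrib = *ℂ-distribˡ , *ℂ-distribʳ
        }
      ; *-comm = *ℂ-comm
      }
    }

  module ℂR = CommutativeRing ℂ-ring
  open import Algebra.Properties.Monoid.Mult ℂR.+-monoid using (×-congʳ) renaming (_×_ to _·_)
  open import Algebra.Properties.Semiring.Mult ℂR.semiring using (×-assoc-*)

  -- The element `suc d · 1#` is represented by constant rational sequences, so its inverse u can be
  -- written down explicitly.
  suc-·-cancel : ∀ d {z w} → suc d · z ≈ℂ suc d · w → z ≈ℂ w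
  suc-·-cancel d {z} {w} dz≈dw = begin
    z                           ≈⟨ divided z ⟨
    u *ℂ (suc d · z)            ≈⟨ ℂR.*-congˡ dz≈dw ⟩
    u *ℂ (suc d · w)            ≈⟨ divided w ⟩
    w                           ∎
    where
    open import Relation.Binary.Reasoning.Setoid ℂR.setoid

    fromℕ : ℕ → ℚ
    fromℕ zero    = 0ℚ
    fromℕ (suc k) = 1ℚ ℚ.+ fromℕ k

    fromℕ≥0 : ∀ k → 0ℚ ℚ.≤ fromℕ k
    fromℕ≥0 zero    = ℚ.≤-refl
    fromℕ≥0 (suc k) = ℚ.+-mono-≤ (ℚ.nonNegative⁻¹ 1ℚ) (fromℕ≥0 k)

    re-·1 : ∀ k n → seq (re (k · 1#)) n ≡ fromℕ k
    re-·1 zero    n = ≡.refl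
    re-·1 (suc k) n = ≡.cong (1ℚ ℚ.+_) (re-·1 k n)

    im-·1 : ∀ k n → seq (im (k · 1#)) n ≡ 0ℚ
    im-·1 zero    n = ≡.refl
    im-·1 (suc k) n = ≡.cong (0ℚ ℚ.+_) (im-·1 k n)

    v : ℚ
    v = fromℕ (suc d)

    instance
      v-nonZero : ℚ.NonZero v
      v-nonZero = ℚ.pos⇒nonZero v {{ℚ.positive (ℚ.+-mono-<-≤ (ℚ.positive⁻¹ 1ℚ) (fromℕ≥0 d))}}

    u : ℂ
    u = fromℚ (ℚ.1/ v) +i fromℚ 0ℚ

    inverse : u *ℂ (suc d · 1#) ≈ℂ 1#
    inverse = pointwiseℂ
      (λ n → ≡.trans
        (≡.cong₂ (λ a b → ℚ.1/ v ℚ.* a ℚ.+ ℚ.- (0ℚ ℚ.* b)) (re-·1 (suc d) n) (im-·1 (suc d) n))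
        (≡.trans (ℚ.+-identityʳ _) (ℚ.*-inverseˡ v)))
      (λ n → ≡.trans
        (≡.cong₂ (λ a b → ℚ.1/ v ℚ.* b ℚ.+ 0ℚ ℚ.* a) (re-·1 (suc d) n) (im-·1 (suc d) n))
        (solve 2 (λ x y → x :* con 0ℚ :+ con 0ℚ :* y := con 0ℚ) ≡.refl (ℚ.1/ v) v))

    divided : ∀ x → u *ℂ (suc d · x) ≈ℂ x
    divided x = begin
      u *ℂ (suc d · x)              ≈⟨ ℂR.*-congˡ (×-congʳ (suc d) (ℂR.*-identityˡ x)) ⟨
      u *ℂ (suc d · (1# *ℂ x))      ≈⟨ ℂR.*-congˡ (×-assoc-* (suc d) 1# x) ⟨
      u *ℂ ((suc d · 1#) *ℂ x)      ≈⟨ ℂR.*-assoc u _ x ⟨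
      u *ℂ (suc d · 1#) *ℂ x        ≈⟨ ℂR.*-congʳ inverse ⟩
      1# *ℂ x                       ≈⟨ ℂR.*-identityˡ x ⟩
      x                             ∎

  norm² : ℂ → ℝ
  norm² z = re z *ℝ re z +ℝ im z *ℝ im z

  -- Phrased with the squared modulus, which is multiplicative by a polynomial identity.
  IsUnit : ℂ → Set
  IsUnit z = norm² z ≈ℝ fromℚ 1ℚ

  unit-𝕋 : (ζ : 𝕋) → IsUnit (proj₁ ζ)
  unit-𝕋 (z , _ , 1≈norm²) = ≈ℝ-trans (≈ℝ-sym 1≈norm²) (pointwise λ _ → ≡.refl)

  unit-1 : IsUnit 1#
  unit-1 = pointwise λ _ → ≡.refl

  unit-* : ∀ {z w} → IsUnit z → IsUnit w → IsUnit (z *ℂ w)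
  unit-* {z} {w} ∣z∣≈1 ∣w∣≈1 = ≈ℝ-trans (pointwise multiplicative)
    (≈ℝ-trans (*ℝ-cong ∣z∣≈1 ∣w∣≈1) (pointwise λ _ → ≡.refl))
    where
    multiplicative : ∀ n → seq (norm² (z *ℂ w)) n ≡ seq (norm² z *ℝ norm² w) n
    multiplicative n = solve 4 (λ a b c d →
      (a :* c :+ :- (b :* d)) :* (a :* c :+ :- (b :* d)) :+ (a :* d :+ b :* c) :* (a :* d :+ b :* c) :=
      (a :* a :+ b :* b) :* (c :* c :+ d :* d)) ≡.refl
      (seq (re z) n) (seq (im z) n) (seq (re w) n) (seq (im w) n)

  0≤p*p : ∀ p → 0ℚ ℚ.≤ p ℚ.* p
  0≤p*p p with ℚ.≤-total 0ℚ p
  ... | inj₁ 0≤p = ≡.subst (ℚ._≤ p ℚ.* p) (ℚ.*-zeroʳ p) (ℚ.*-monoˡ-≤-nonNeg p {{ℚ.nonNegative 0≤p}} 0≤p)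
  ... | inj₂ p≤0 = ≡.subst (ℚ._≤ p ℚ.* p) (ℚ.*-zeroʳ p) (ℚ.*-monoˡ-≤-nonPos p {{ℚ.nonPositive p≤0}} p≤0)

  *-mono-≤ : ∀ {p q} → 0ℚ ℚ.≤ p → p ℚ.≤ q → p ℚ.* p ℚ.≤ q ℚ.* q
  *-mono-≤ {p} {q} 0≤p p≤q = ℚ.≤-trans
    (ℚ.*-monoˡ-≤-nonNeg p {{ℚ.nonNegative 0≤p}} p≤q)
    (ℚ.*-monoʳ-≤-nonNeg q {{ℚ.nonNegative (ℚ.≤-trans 0≤p p≤q)}} p≤q)

  -- The tolerance ε² for the squares suffices: a term of absolute value at least ε has square at
  -- least ε².
  null-sqrt : ∀ {f} → Null (λ n → f n ℚ.* f n) → Null f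
  null-sqrt {f} f²→0 ε 0<ε with f²→0 (ε ℚ.* ε) 0<ε²
    where
    0<ε² : 0ℚ ℚ.< ε ℚ.* ε
    0<ε² = ≡.subst (ℚ._< ε ℚ.* ε) (ℚ.*-zeroʳ ε) (ℚ.*-monoʳ-<-pos ε {{ℚ.positive 0<ε}} 0<ε)
  ... | N , small = N , λ n N≤n → ℚ.≰⇒> λ ε≤∣f∣ → ℚ.<-irrefl ≡.refl (ℚ.<-≤-trans (small n N≤n)
    (≡.subst (ε ℚ.* ε ℚ.≤_) (≡.sym (ℚ.∣p*q∣≡∣p∣*∣q∣ (f n) (f n))) (*-mono-≤ (ℚ.<⇒≤ 0<ε) ε≤∣f∣)))

  -- Otherwise a ≥ 1 + ε, hence a² + b² ≥ (1 + ε)² ≥ 1 + ε, against the assumption. The same ε thus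
  -- serves hypothesis and conclusion.
  re-close : ∀ a b {ε} → 0ℚ ℚ.< ε → ℚ.∣ (a ℚ.* a ℚ.+ b ℚ.* b) ℚ.- 1ℚ ∣ ℚ.< ε → 0ℚ ℚ.< (1ℚ ℚ.- a) ℚ.+ ε
  re-close a b {ε} 0<ε ∣a²+b²-1∣<ε = ℚ.≰⇒> λ 1-a+ε≤0 → ℚ.<-irrefl ≡.refl (ℚ.<-≤-trans ∣a²+b²-1∣<ε (begin
    ε                                      ≡⟨ solve 1 (λ e → e := con 1ℚ :+ e :- con 1ℚ) ≡.refl ε ⟩
    c ℚ.- 1ℚ                               ≤⟨ ℚ.+-monoˡ-≤ (ℚ.- 1ℚ) (c≤a²+b² 1-a+ε≤0) ⟩
    (a ℚ.* a ℚ.+ b ℚ.* b) ℚ.- 1ℚ           ≤⟨ p≤∣p∣ _ ⟩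
    ℚ.∣ (a ℚ.* a ℚ.+ b ℚ.* b) ℚ.- 1ℚ ∣     ∎))
    where
    open ℚ.≤-Reasoning

    c : ℚ
    c = 1ℚ ℚ.+ ε

    1≤c : 1ℚ ℚ.≤ c
    1≤c = ≡.subst (ℚ._≤ c) (ℚ.+-identityʳ 1ℚ) (ℚ.+-monoʳ-≤ 1ℚ (ℚ.<⇒≤ 0<ε))

    0≤c : 0ℚ ℚ.≤ c
    0≤c = ℚ.≤-trans (ℚ.nonNegative⁻¹ 1ℚ) 1≤c

    c≤a²+b² : (1ℚ ℚ.- a) ℚ.+ ε ℚ.≤ 0ℚ → c ℚ.≤ a ℚ.* a ℚ.+ b ℚ.* b
    c≤a²+b² 1-a+ε≤0 = begin
      c                                ≡⟨ ℚ.*-identityʳ c ⟨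
      c ℚ.* 1ℚ                         ≤⟨ ℚ.*-monoˡ-≤-nonNeg c {{ℚ.nonNegative 0≤c}} 1≤c ⟩
      c ℚ.* c                          ≤⟨ *-mono-≤ 0≤c c≤a ⟩
      a ℚ.* a                          ≡⟨ ℚ.+-identityʳ _ ⟨
      a ℚ.* a ℚ.+ 0ℚ                   ≤⟨ ℚ.+-monoʳ-≤ (a ℚ.* a) (0≤p*p b) ⟩
      a ℚ.* a ℚ.+ b ℚ.* b              ∎
      where
      c≤a : c ℚ.≤ a
      c≤a = begin
        c                              ≡⟨ solve 2 (λ a e → con 1ℚ :+ e := con 1ℚ :- a :+ e :+ a) ≡.refl a ε ⟩
        (1ℚ ℚ.- a) ℚ.+ ε ℚ.+ a         ≤⟨ ℚ.+-monoˡ-≤ a 1-a+ε≤0 ⟩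
        0ℚ ℚ.+ a                       ≡⟨ ℚ.+-identityˡ a ⟩
        a                              ∎

  0≤re-1-unit : ∀ {z} → IsUnit z → 0≤ re (1# +ℂ -ℂ z)
  0≤re-1-unit {z} (mk≈ near) = mk≤ λ ε 0<ε →
    let N , small = near ε 0<ε in
    N , λ n N≤n → re-close (seq (re z) n) (seq (im z) n) 0<ε (small n N≤n)

  -- For z = a + bi one has b² = (a² + b² - 1) + (1 - a)(1 + a), a sum of two null sequences.
  unit-re≈1⇒≈1 : ∀ {z} → IsUnit z → re (1# +ℂ -ℂ z) ≈ℝ fromℚ 0ℚ → z ≈ℂ 1#
  unit-re≈1⇒≈1 {z} (mk≈ norm²-1) 1-re≈0 =
    mk≈ (null-cong (λ n → solve 1 (λ a → :- (con 1ℚ :- a) := a :- con 1ℚ) ≡.refl (seq (re z) n)) (null-neg 1-re→0)) ,≈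
    null⇒≈0 (null-sqrt (null-cong
      (λ n → solve 2 (λ a b →
        ((a :* a :+ b :* b) :- con 1ℚ) :+ (con 1ℚ :- a) :* (con 1ℚ :+ a) := b :* b) ≡.refl
        (seq (re z) n) (seq (im z) n))
      (null-+ norm²-1 (null-* 1-re→0 (fromℚ 1ℚ +ℝ re z)))))
    where
    1-re→0 : Null (λ n → 1ℚ ℚ.- seq (re z) n)
    1-re→0 = ≈0⇒null 1-re≈0

-- Cutting closed walks at a repeated vertex.

module Walks {n} (D : Digraph n) where
  open Digraph D

  infixr 5 _++_

  _++_ : ∀ {u v w} → Walk u v → Walk v w → Walk u w
  []      ++ q = q
  (a ∷ p) ++ q = a ∷ (p ++ q)

  length-++ : ∀ {u v w} (p : Walk u v) (q : Walk v w) → length (p ++ q) ≡ length p ℕ.+ length q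
  length-++ []      q = ≡.refl
  length-++ (a ∷ p) q = ≡.cong suc (length-++ p q)

  -- Since `vertices` omits the final vertex, something always remains after an occurrence of x.
  split : ∀ {u w x} (p : Walk u w) → x ∈ vertices p →
    ∃₂ λ (p₁ : Walk u x) (p₂ : Walk x w) → p ≡ p₁ ++ p₂ × 0 ℕ.< length p₂
  split (a ∷ p) (here ≡.refl) = [] , a ∷ p , ≡.refl , s≤s z≤n
  split (a ∷ p) (there x∈p) with split p x∈p
  ... | p₁ , p₂ , ≡.refl , 0<∣p₂∣ = a ∷ p₁ , p₂ , ≡.refl , 0<∣p₂∣

  -- The two positivity conditions make both `loop` and `before ++ after` strictly shorter than p.
  record Detour {u w} (p : Walk u w) : Set where
    constructor detour
    field
      {turn}   : Fin n
      before   : Walk u turn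
      loop     : Walk turn turn
      after    : Walk turn w
      splits   : p ≡ before ++ loop ++ after
      0<∣loop∣  : 0 ℕ.< length loop
      0<∣after∣ : 0 ℕ.< length after

  unique⊎detour : ∀ {u w} (p : Walk u w) → Unique (vertices p) ⊎ Detour p
  unique⊎detour [] = inj₁ []
  unique⊎detour (_∷_ {u} a p) with unique⊎detour p
  ... | inj₂ (detour p₁ q p₂ ≡.refl 0<∣q∣ 0<∣p₂∣) = inj₂ (detour (a ∷ p₁) q p₂ ≡.refl 0<∣q∣ 0<∣p₂∣)
  ... | inj₁ unique with _∈?_ _≟_ u (vertices p)
  ...   | no u∉p = inj₁ (¬Any⇒All¬ _ u∉p ∷ unique)
  ...   | yes u∈p with split p u∈p
  ...     | p₁ , p₂ , ≡.refl , 0<∣p₂∣ = inj₂ (detour [] (a ∷ p₁) p₂ ≡.refl (s≤s z≤n) 0<∣p₂∣)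

-- Gains of closed walks.

module Balance {n} (Φ : GainDigraph n) where
  open GainDigraph Φ
  open Walks digraph
  open Complexes
  open ℂR hiding (zero)
  open import Relation.Binary.Reasoning.Setoid setoid

  gain-++ : ∀ {u v w} (p : Walk u v) (q : Walk v w) → gain (p ++ q) ≈ gain p * gain q
  gain-++ []      q = sym (*-identityˡ _)
  gain-++ (a ∷ p) q = trans (*-congˡ (gain-++ p q)) (sym (*-assoc _ _ _))

  module _ (balanced : CycleBalanced) where

    -- The bound k carries the induction on length, because neither `q` nor `p₁ ++ p₂` is
    -- structurally part of p.
    gain-closed′ : ∀ k {v} (p : Walk v v) → length p ℕ.< k → gain p ≈ 1#
    gain-closed′ (suc k) []      _ = refl
    -- A single closed arc would be a loop; every other nonempty closed walk has the length 2
    -- required of a cycle.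
    gain-closed′ (suc k) {v} (a ∷ []) _ = ⊥-elim (≡.subst T (loopless v) a)
    gain-closed′ (suc k) p@(_ ∷ _ ∷ _) (s≤s ∣p∣≤k) with unique⊎detour p
    ... | inj₁ unique = balanced p (s≤s (s≤s z≤n) , unique)
    ... | inj₂ (detour p₁ q p₂ splits 0<∣q∣ 0<∣p₂∣) = begin
      gain p                          ≡⟨ ≡.cong gain splits ⟩
      gain (p₁ ++ q ++ p₂)            ≈⟨ trans (gain-++ p₁ (q ++ p₂)) (*-congˡ (gain-++ q p₂)) ⟩
      gain p₁ * (gain q * gain p₂)    ≈⟨ *-congˡ (trans (*-congʳ (gain-closed′ k q ∣q∣<k)) (*-identityˡ _)) ⟩
      gain p₁ * gain p₂               ≈⟨ gain-++ p₁ p₂ ⟨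
      gain (p₁ ++ p₂)                 ≈⟨ gain-closed′ k (p₁ ++ p₂) ∣p₁p₂∣<k ⟩
      1#                              ∎
      where
      total : length p₁ ℕ.+ (length q ℕ.+ length p₂) ℕ.≤ k
      total = ≡.subst (ℕ._≤ k)
        (≡.trans (≡.cong length splits) (≡.trans (length-++ p₁ _) (≡.cong (length p₁ ℕ.+_) (length-++ q p₂)))) ∣p∣≤k

      ∣q∣<k : length q ℕ.< k
      ∣q∣<k = ℕ.<-≤-trans (ℕ.m<m+n (length q) 0<∣p₂∣) (ℕ.≤-trans (ℕ.m≤n+m _ (length p₁)) total)

      ∣p₁p₂∣<k : length (p₁ ++ p₂) ℕ.< k
      ∣p₁p₂∣<k = ≡.subst (ℕ._< k) (≡.sym (length-++ p₁ p₂))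
        (ℕ.<-≤-trans (ℕ.+-monoʳ-< (length p₁) (ℕ.m<n+m (length p₂) 0<∣q∣)) total)

    gain-closed : ∀ {v} (p : Walk v v) → gain p ≈ 1#
    gain-closed p = gain-closed′ _ p ℕ.≤-refl

  unit-gain : ∀ {u v} (p : Walk u v) → IsUnit (gain p)
  unit-gain []      = unit-1
  unit-gain (a ∷ p) = unit-* {proj₁ (φ a)} {gain p} (unit-𝕋 (φ a)) (unit-gain p)

-- Sums over walks of fixed length.

module WalkSums {n} (D : Digraph n) where
  open Digraph D
  open Reals
  open Complexes
  open ℂR hiding (zero)
  open import Algebra.Properties.Semiring.Sum semiring
  open DeterminantProperties ℂ-ring using (δ)
  open CharacteristicPolynomialProperties ℂ-ring using (power)
  open import Relation.Binary.Reasoning.Setoid setoid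

  entry-cong : ∀ b {f g : T b → ℂ} → (∀ a → f a ≈ g a) → entry b f ≈ entry b g
  entry-cong true  f≈g = f≈g tt
  entry-cong false f≈g = refl

  entry-+ : ∀ b (f g : T b → ℂ) → entry b (λ a → f a + g a) ≈ entry b f + entry b g
  entry-+ true  f g = refl
  entry-+ false f g = sym (+-identityˡ 0#)

  *-entry : ∀ b c (f : T b → ℂ) → c * entry b f ≈ entry b (λ a → c * f a)
  *-entry true  c f = refl
  *-entry false c f = zeroʳ c

  entry-* : ∀ b (f : T b → ℂ) c → entry b f * c ≈ entry b (λ a → f a * c)
  entry-* true  f c = refl
  entry-* false f c = zeroˡ c

  -- Walks are not listed. The recursion on the first arc mirrors that of `power`, and the summand
  -- may depend on the whole walk.
  walkSum : ∀ (s : ℕ) u v → (Walk u v → ℂ) → ℂ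
  walkSum zero    u v f with u ≟ v
  ... | yes ≡.refl = f []
  ... | no _       = 0#
  walkSum (suc s) u v f = sum λ w → entry (arc? u w) λ a → walkSum s w v λ p → f (a ∷ p)

  walkSum-cong : ∀ s u v {f g : Walk u v → ℂ} → (∀ p → f p ≈ g p) → walkSum s u v f ≈ walkSum s u v g
  walkSum-cong zero    u v f≈g with u ≟ v
  ... | yes ≡.refl = f≈g []
  ... | no _       = refl
  walkSum-cong (suc s) u v f≈g = sum-cong-≋ λ w →
    entry-cong (arc? u w) λ a → walkSum-cong s w v λ p → f≈g (a ∷ p)

  walkSum-+ : ∀ s u v (f g : Walk u v → ℂ) →
    walkSum s u v (λ p → f p + g p) ≈ walkSum s u v f + walkSum s u v g
  walkSum-+ zero    u v f g with u ≟ v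
  ... | yes ≡.refl = refl
  ... | no _       = sym (+-identityˡ 0#)
  walkSum-+ (suc s) u v f g = trans
    (sum-cong-≋ λ w → trans
      (entry-cong (arc? u w) λ a → walkSum-+ s w v (λ p → f (a ∷ p)) (λ p → g (a ∷ p)))
      (entry-+ (arc? u w) _ _))
    (∑-distrib-+ (λ w → entry (arc? u w) λ a → walkSum s w v λ p → f (a ∷ p)) _)

  *-walkSum : ∀ s u v c (f : Walk u v → ℂ) → c * walkSum s u v f ≈ walkSum s u v (λ p → c * f p)
  *-walkSum zero    u v c f with u ≟ v
  ... | yes ≡.refl = refl
  ... | no _       = zeroʳ c
  *-walkSum (suc s) u v c f = trans
    (*-distribˡ-sum c (λ w → entry (arc? u w) λ a → walkSum s w v λ p → f (a ∷ p)))
    (sum-cong-≋ λ w → trans (*-entry (arc? u w) c _)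
      (entry-cong (arc? u w) λ a → *-walkSum s w v c (λ p → f (a ∷ p))))

  -- The weight g is any function multiplicative along walks, so that the gain and the constant 1
  -- are both covered.
  power-walkSum : ∀ (M : Matrix ℂ n) (ψ : ∀ {u v} → Arc u v → ℂ) (g : ∀ {u v} → Walk u v → ℂ) →
    (∀ u v → M u v ≈ entry (arc? u v) ψ) →
    (∀ {u} → g ([] {u}) ≈ 1#) →
    (∀ {u v w} (a : Arc u v) (p : Walk v w) → g (a ∷ p) ≈ ψ a * g p) →
    ∀ s u v → power M s u v ≈ walkSum s u v g
  power-walkSum M ψ g M≈ψ g-[] g-∷ = go
    where
    go : ∀ s u v → power M s u v ≈ walkSum s u v g
    go zero u v with u ≟ v
    ... | yes ≡.refl = sym g-[]
    ... | no _       = refl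
    go (suc s) u v = sum-cong-≋ λ w → begin
      M u w * power M s w v
        ≈⟨ *-cong (M≈ψ u w) (go s w v) ⟩
      entry (arc? u w) ψ * walkSum s w v g
        ≈⟨ entry-* (arc? u w) ψ _ ⟩
      entry (arc? u w) (λ a → ψ a * walkSum s w v g)
        ≈⟨ entry-cong (arc? u w) (λ a → trans (*-walkSum s w v (ψ a) g) (walkSum-cong s w v λ p → sym (g-∷ a p))) ⟩
      entry (arc? u w) (λ a → walkSum s w v (λ p → g (a ∷ p))) ∎

  sum-0≤ : ∀ {m} (f : Vector ℂ m) → (∀ i → 0≤ re (f i)) → 0≤ re (sum f)
  sum-0≤ {zero}  f 0≤f = 0≤-zero
  sum-0≤ {suc m} f 0≤f = 0≤-+ (0≤f zero) (sum-0≤ (f ∘ suc) (0≤f ∘ suc))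

  walkSum-0≤ : ∀ s u v {f : Walk u v → ℂ} → (∀ p → 0≤ re (f p)) → 0≤ re (walkSum s u v f)
  entry-0≤ : ∀ b {f : T b → ℂ} → (∀ a → 0≤ re (f a)) → 0≤ re (entry b f)
  entry-0≤ true  0≤f = 0≤f tt
  entry-0≤ false 0≤f = 0≤-zero

  walkSum-0≤ zero    u v 0≤f with u ≟ v
  ... | yes ≡.refl = 0≤f []
  ... | no _       = 0≤-zero
  walkSum-0≤ (suc s) u v 0≤f = sum-0≤ _ λ w →
    entry-0≤ (arc? u w) λ a → walkSum-0≤ s w v λ p → 0≤f (a ∷ p)

  sum-0≤-≈0 : ∀ {m} (f : Vector ℂ m) → (∀ i → 0≤ re (f i)) → re (sum f) ≈ℝ re 0# → ∀ i → re (f i) ≈ℝ re 0#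
  sum-0≤-≈0 f 0≤f Σ≈0 zero    = 0≤-+≈0 (0≤f zero) (sum-0≤ (f ∘ suc) (0≤f ∘ suc)) Σ≈0
  sum-0≤-≈0 f 0≤f Σ≈0 (suc i) = sum-0≤-≈0 (f ∘ suc) (0≤f ∘ suc)
    (0≤-+≈0 (sum-0≤ (f ∘ suc) (0≤f ∘ suc)) (0≤f zero) (≈ℝ-trans (_≈ℂ_.re≈ (+-comm (sum (f ∘ suc)) (f zero))) Σ≈0)) i

  entry-≈0 : ∀ b {f : T b → ℂ} → re (entry b f) ≈ℝ re 0# → ∀ a → re (f a) ≈ℝ re 0#
  entry-≈0 true f≈0 tt = f≈0

  -- The term of p is reached by following its arcs: in a vanishing sum with nonnegative real parts
  -- each branch has real part 0, in particular the one p takes.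
  walkSum-0≤-≈0 : ∀ s u v {f : Walk u v → ℂ} → (∀ p → 0≤ re (f p)) → re (walkSum s u v f) ≈ℝ re 0# →
    ∀ p → length p ≡ s → re (f p) ≈ℝ re 0#
  walkSum-0≤-≈0 zero    u v 0≤f Σ≈0 []            _      with u ≟ u
  ... | yes ≡.refl = Σ≈0
  ... | no u≢u     = contradiction ≡.refl u≢u
  walkSum-0≤-≈0 (suc s) u v 0≤f Σ≈0 (_∷_ {v = w} a p) ∣p∣≡s =
    walkSum-0≤-≈0 s w v (λ q → 0≤f (a ∷ q))
      (entry-≈0 (arc? u w)
        (sum-0≤-≈0 _ (λ w → entry-0≤ (arc? u w) λ a → walkSum-0≤ s w v λ q → 0≤f (a ∷ q)) Σ≈0 w) a)
      p (ℕ.suc-injective ∣p∣≡s)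

-- Power traces as sums over closed walks.

module Traces {n} (Φ : GainDigraph n) where
  open GainDigraph Φ
  open Balance Φ
  open WalkSums digraph
  open Reals
  open Complexes
  open ℂR hiding (zero)
  open import Algebra.Properties.Semiring.Sum semiring
  open import Algebra.Properties.Group +-group using (identityʳ-unique)
  open CharacteristicPolynomialProperties ℂ-ring using (power; trace)
  open import Relation.Binary.Reasoning.Setoid setoid

  -- Closed walks carry a base vertex, as in the trace; a cycle of length s is counted once from
  -- each of its s vertices.
  closedWalkSum : ℕ → (∀ {v} → Walk v v → ℂ) → ℂ
  closedWalkSum s f = sum λ v → walkSum s v v f

  trace-gain : ∀ s → trace (power (gainAdjacency Φ) s) ≈ closedWalkSum s gain
  trace-gain s = sum-cong-≋ λ v → power-walkSum (gainAdjacency Φ) (λ a → proj₁ (φ a)) gain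
    (λ _ _ → refl) refl (λ _ _ → refl) s v v

  trace-one : ∀ s → trace (power (adjacency digraph) s) ≈ closedWalkSum s (λ _ → 1#)
  trace-one s = sum-cong-≋ λ v → power-walkSum (adjacency digraph) (λ _ → 1#) (λ _ → 1#)
    (λ u w → if-entry (arc? u w)) refl (λ _ _ → sym (*-identityˡ 1#)) s v v
    where
    if-entry : ∀ b → (if b then 1# else 0#) ≈ entry b (λ _ → 1#)
    if-entry true  = refl
    if-entry false = refl

  balanced⇒traces : CycleBalanced → ∀ s → trace (power (gainAdjacency Φ) s) ≈ trace (power (adjacency digraph) s)
  balanced⇒traces balanced s = trans (trace-gain s)
    (trans (sum-cong-≋ λ v → walkSum-cong s v v (gain-closed balanced)) (sym (trace-one s)))

  -- The power used is s = `length p`, so that `gain p` is one of the summands of the trace.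
  traces⇒balanced : (∀ s → trace (power (gainAdjacency Φ) s) ≈ trace (power (adjacency digraph) s)) → CycleBalanced
  traces⇒balanced traces {v} p _ = unit-re≈1⇒≈1 (unit-gain p)
    (walkSum-0≤-≈0 s v v 0≤defect (sum-0≤-≈0 (λ v → walkSum s v v defect) (λ v → walkSum-0≤ s v v 0≤defect)
      (_≈ℂ_.re≈ Σdefect≈0) v) p ≡.refl)
    where
    s = length p

    defect : ∀ {v} → Walk v v → ℂ
    defect q = 1# - gain q

    0≤defect : ∀ {v} (q : Walk v v) → 0≤ re (defect q)
    0≤defect q = 0≤re-1-unit {gain q} (unit-gain q)

    -- Adding the defects to the gains gives the number of closed walks of length s, which the
    -- traces identify with the sum of the gains.
    Σdefect≈0 : closedWalkSum s defect ≈ 0#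
    Σdefect≈0 = identityʳ-unique (closedWalkSum s gain) _ (begin
      closedWalkSum s gain + closedWalkSum s defect
        ≈⟨ ∑-distrib-+ (λ v → walkSum s v v gain) _ ⟨
      sum (λ v → walkSum s v v gain + walkSum s v v defect)
        ≈⟨ sum-cong-≋ (λ v → walkSum-+ s v v gain defect) ⟨
      closedWalkSum s (λ q → gain q + defect q)
        ≈⟨ sum-cong-≋ (λ v → walkSum-cong s v v λ q → gain+defect q) ⟩
      closedWalkSum s (λ _ → 1#)
        ≈⟨ trace-one s ⟨
      trace (power (adjacency digraph) s)
        ≈⟨ traces s ⟨
      trace (power (gainAdjacency Φ) s)
        ≈⟨ trace-gain s ⟩
      closedWalkSum s gain ∎)
      where
      gain+defect : ∀ {v} (q : Walk v v) → gain q + defect q ≈ 1#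
      gain+defect q = begin
        gain q + (1# - gain q)    ≈⟨ +-comm _ _ ⟩
        1# - gain q + gain q      ≈⟨ +-assoc _ _ _ ⟩
        1# + (- gain q + gain q)  ≈⟨ +-congˡ (-‿inverseˡ _) ⟩
        1# + 0#                   ≈⟨ +-identityʳ _ ⟩
        1#                        ∎

theorem2p6 : ∀ {n : ℕ} (Φ : GainDigraph n) →
    GainDigraph.CycleBalanced Φ ⇔ Cospectral (gainAdjacency Φ) (adjacency (GainDigraph.digraph Φ))
theorem2p6 Φ = mk⇔ balanced⇒cospectral cospectral⇒balanced
  where
  open GainDigraph Φ using (CycleBalanced; digraph)
  open Traces Φ
  open CharacteristicPolynomialProperties Complexes.ℂ-ring

  balanced⇒cospectral : CycleBalanced → Cospectral (gainAdjacency Φ) (adjacency digraph)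
  balanced⇒cospectral balanced = trace-power⇒cospectral (gainAdjacency Φ) (adjacency digraph)
    Complexes.suc-·-cancel (balanced⇒traces balanced)

  cospectral⇒balanced : Cospectral (gainAdjacency Φ) (adjacency digraph) → CycleBalanced
  cospectral⇒balanced cospectral = traces⇒balanced
    (cospectral⇒trace-power (gainAdjacency Φ) (adjacency digraph) cospectral)
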